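{- Let $r\ge 1$, let $\mathbf m\in\mathcal M_r$ be a Motzkin path, let $T'_{\mathbf m}$ be the transfer matrix of the compactified graph $\Gamma'_{\mathbf m}$, let $\sigma_{\mathbf m}=(i_1,\dots,i_r)$ and $\tau_{\mathbf m}=(j_1,\dots,j_r)$, and let $$P_{\mathbf m}=(f_{i_1}f_{i_2}\cdots f_{i_r})\,(d_1d_2\cdots d_{r+1})\,(e_{j_1}e_{j_2}\cdots e_{j_r}).$$ Then $$(I-T'_{\mathbf m})^{ -1}=(I-tP_{\mathbf m})^{ -1}\,(f_{i_1}f_{i_2}\cdots f_{i_r}),$$ which allows one to rewrite the generating function $\big((I-T'_{\mathbf m})^{ -1}\big)_{1,1}$ of weighted paths from vertex $1$ to vertex $1$ on $\Gamma'_{\mathbf m}$ as $$\big((I-T'_{\mathbf m})^{ -1}\big)_{1,1}=\begin{cases}\big((I-tP_{\mathbf m})^{ -1}\big)_{1,1}+\big((I-tP_{\mathbf m})^{ -1}\big)_{1,2} & \text{if } a_1>1,\\[1mm] \displaystyle\sum_{a=a_1}^{a_2+1}\big((I-tP_{\mathbf m})^{ -1}\big)_{1,a} & \text{if } a_1=1,\end{cases}$$ where $[a_1,a_2]$ is the first maximal ascending segment of $\mathbf m$.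
   Context: Motzkin paths: $\mathcal M_r$ is the set of integer vectors $\mathbf m=(m_1,\dots,m_r)$ with $|m_\alpha-m_{\alpha+1}|\le 1$ for $1\le\alpha<r$ and $\min_\alpha m_\alpha=0$. A maximal ascending (resp. descending) segment of $\mathbf m$ is a maximal interval $[\alpha,\beta]\subset\{1,\dots,r\}$, $\beta>\alpha$, of consecutive indices with $m_{\alpha+j}=m_\alpha+j$ (resp. $m_{\alpha+j}=m_\alpha-j$) for $0\le j\le\beta-\alpha$. The maximal ascending segments are written, from left to right, $[a_1,a_2],[a_3,a_4],\dots,[a_{2k-1},a_{2k}]$ with $(a_1,\dots,a_{2k})$ increasing. $Q$-system: $\{R_{\alpha,n}\}_{0\le\alpha\le r+1,n\in\mathbb Z}$ is the solution of $R_{\alpha,n+1}R_{\alpha,n-1}=R_{\alpha,n}^2+R_{\alpha+1,n}R_{\alpha-1,n}$ ($1\le\alpha\le r$), $R_{0,n}=R_{r+1,n}=1$, with initial data $R_{\alpha,0},R_{\alpha,1}$ ($1\le\alpha\le r$) independent indeterminates. Weights: put $\lambda_{\alpha,n}=R_{\alpha,n+1}/R_{\alpha,n}$ and $\mu_{\alpha,n}=R_{\alpha,n}/R_{\alpha-1,n}$. For $1\le \alpha\le r+1$, $y_{2\alpha-1}=\lambda_{\alpha,m_\alpha}/\lambda_{\alpha-1,m_{\alpha-1}}$; for $1\le\alpha\le r$, $y_{2\alpha}=\frac{\mu_{\alpha+1,m_\alpha+1}}{\mu_{\alpha,m_\alpha}}\,A_\alpha B_\alpha$, where $A_\alpha=\lambda_{\alpha+1,m_{\alpha+1}}/\lambda_{\alpha+1,m_\alpha}$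 if $m_\alpha=m_{\alpha+1}+1$ and $A_\alpha=1$ otherwise, and $B_\alpha=\lambda_{\alpha-1,m_\alpha}/\lambda_{\alpha-1,m_{\alpha-1}}$ if $m_{\alpha-1}=m_\alpha+1$ and $B_\alpha=1$ otherwise. (Since $\lambda_{0,n}=\lambda_{r+1,n}=1$, the values of $m_0,m_{r+1}$ are irrelevant.) The compactified graph $\Gamma'_{\mathbf m}$ has vertices $1,\dots,r+1$; oriented edges $i\to i+1$ with weight $1$ and $i+1\to i$ with weight $t y_{2i}$ ($1\le i\le r$); loops $i\to i$ with weight $t y_{2i-1}$ ($1\le i\le r+1$). In addition: for every maximal descending segment $[\alpha,\alpha+i-1]$ of $\mathbf m$, $i\ge 2$, it has edges $\alpha+p\to\alpha+q$ for all $0\le q$, $q+2\le p\le i$, with weight $t\,\prod_{j=\alpha+q}^{\alpha+p-1}y_{2j}\big/\prod_{j=\alpha+q+1}^{\alpha+p-1}y_{2j-1}$; for every maximal ascending segment $[\alpha,\alpha+i-1]$, $i\ge2$, it has edges $\alpha+q\to\alpha+p$ for all $0\le q$, $q+2\le p\le i$, with weight $(-1)^{p-q-1}$. The transfer matrix $T'_{\mathbf m}$ is the $(r+1)\times(r+1)$ matrix whose $(b,a)$ entry (row $b$, column $a$) is the weight of the edge $a\to b$, or $0$ if there is none. Inverses are taken over formal power series in $t$. Sequences: $\sigma_{\mathbf m}$ is obtained from the sequence $(r,r-1,\dots,1)$ by reversing, for each maximal ascending segment $[\alpha,\beta]$ of $\mathbf m$, the block $(\beta,\beta-1,\dots,\alpha)$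 into $(\alpha,\alpha+1,\dots,\beta)$. $\tau_{\mathbf m}$ is obtained from $(r,r-1,\dots,1)$ in the same way using the maximal descending segments. For example, $\mathbf m=(2,1,2,2,2,1,0,0,1)$ gives $\sigma_{\mathbf m}=(8,9,7,6,5,4,2,3,1)$ and $\tau_{\mathbf m}=(9,8,5,6,7,4,3,1,2)$. Elementary matrices of size $(r+1)\times(r+1)$, with $E_{i,j}$ the matrix units: $f_i=I+E_{i+1,i}$ and $e_i=I+\frac{y_{2i}}{y_{2i-1}}E_{i,i+1}$ for $1\le i\le r$; $d_i=I+(y_{2i-1}-1)E_{i,i}$ for $1\le i\le r+1$.
   Formalization: The printed (1,1)-entry formula is false (e.g. r=2, m=(0,1)); proved instead: the sum of first-row entries over a=1..a_1+1 if a_1>1, the first two entries if a_1=1, and the sum over a=1..r+1 if there is no ascending segment. The first identity is as printed. -}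

module Defs where

open import Level using (Level; _⊔_) renaming (suc to lsuc)
open import Algebra.Bundles using (CommutativeRing)
open import Algebra.Bundles.Raw using (RawRing)
open import Data.Bool.Base using (if_then_else_)
open import Data.Fin.Base using (Fin; toℕ; fromℕ<)
import Data.Fin.Properties as Finₚ
open import Data.Integer.Base as ℤ using (ℤ; +_; -[1+_]; 0ℤ; 1ℤ; -1ℤ)
import Data.Integer.Properties as ℤₚ
open import Data.List.Base as List using (List; applyUpTo; applyDownFrom; cartesianProduct)
open import Data.List.Membership.Propositional using (_∈_; find; lose)
open import Data.List.Relation.Unary.Any using (Any; any?)
open import Data.Nat.Base as ℕ using (ℕ; zero; suc; pred; _≤_; _<_; _∸_; s≤s)
import Data.Nat.Properties as ℕₚ
open import Data.Product.Base using (_×_; _,_; ∃-syntax)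
open import Data.Vec.Base as Vec using (Vec)
open import Data.Vec.Functional using (Vector; _++_)
open import Function.Definitions using (Injective)
open import Relation.Binary.PropositionalEquality using (_≡_; refl; sym; trans; cong; subst; subst₂)
open import Relation.Nullary.Decidable using (Dec; yes; no; map′; _×-dec_; does)
open import Relation.Nullary.Negation using (¬_; contradiction)

import Algebra.Definitions
import Algebra.Definitions.RawSemiring as RawSemiringDefs

private
  variable
    c ℓ : Level

[_⋯_] : ℕ → ℕ → List ℕ
[ lo ⋯ hi ] = applyUpTo (lo ℕ.+_) (suc hi ∸ lo)

-- The inverse is total, but its value at 0 is unspecified.
record Field c ℓ : Set (lsuc (c ⊔ ℓ)) where
  infix 9 _⁻¹
  infixl 7 _/_
  field
    commutativeRing : CommutativeRing c ℓ
  open CommutativeRing commutativeRing public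
  field
    _⁻¹      : Carrier → Carrier
    ⁻¹-cong  : ∀ {x y} → x ≈ y → x ⁻¹ ≈ y ⁻¹
    1≉0      : ¬ (1# ≈ 0#)
    *-inverse : ∀ {x} → ¬ (x ≈ 0#) → x * x ⁻¹ ≈ 1#

  _/_ : Carrier → Carrier → Carrier
  x / y = x * y ⁻¹

module _ (K : Field c ℓ) where
  open Field K
  open RawSemiringDefs (RawRing.rawSemiring rawRing) using (sum; product; _^_) renaming (_×_ to _×ℕ_)

  intMul : ℤ → Carrier → Carrier
  intMul (+ n)    x = n ×ℕ x
  intMul -[1+ n ] x = - (suc n ×ℕ x)

  monomial : ∀ {n} → Vector Carrier n → Vec ℕ n → Carrier
  monomial x e = product (λ i → x i ^ Vec.lookup e i)

  -- Independence over the prime field ℚ, with denominators cleared: no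
  -- nontrivial ℤ-linear combination of distinct monomials in x vanishes.
  -- (The case of the empty monomial makes K of characteristic 0.)
  AlgebraicallyIndependent : ∀ {n} → Vector Carrier n → Set ℓ
  AlgebraicallyIndependent {n} x =
    ∀ {k} (e : Vector (Vec ℕ n) k) (a : Vector ℤ k) → Injective _≡_ _≡_ e →
    sum (λ i → intMul (a i) (monomial x (e i))) ≈ 0# → ∀ i → a i ≡ 0ℤ

module PowerSeries (A : RawRing c ℓ) where
  open RawRing A
  open RawSemiringDefs rawSemiring using (sum)

  Series : Set c
  Series = ℕ → Carrier

  const : Carrier → Series
  const a zero    = a
  const a (suc _) = 0#

  t : Series
  t (suc zero) = 1#
  t _          = 0#

  rawRing : RawRing c ℓ
  rawRing = record
    { Carrier = Series
    ; _≈_ = λ f g → ∀ n → f n ≈ g n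
    ; _+_ = λ f g n → f n + g n
    ; _*_ = λ f g n → sum {suc n} (λ k → f (toℕ k) * g (n ∸ toℕ k))
    ; -_  = λ f n → - f n
    ; 0#  = const 0#
    ; 1#  = const 1#
    }

-- Rows and columns are labelled 1,…,n: the label of i : Fin n is suc (toℕ i).

label : ∀ {n} → Fin n → ℕ
label i = suc (toℕ i)

module Matrices (A : RawRing c ℓ) (n : ℕ) where
  open RawRing A
  open RawSemiringDefs rawSemiring using (sum)

  infix  4 _≋_
  infixl 6 _⊕_ _⊖_
  infixl 7 _·_ _•_

  Matrix : Set c
  Matrix = Fin n → Fin n → Carrier

  _≋_ : Matrix → Matrix → Set ℓ
  M ≋ N = ∀ i j → M i j ≈ N i j

  _⊕_ _⊖_ _·_ : Matrix → Matrix → Matrix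
  (M ⊕ N) i j = M i j + N i j
  (M ⊖ N) i j = M i j + - N i j
  (M · N) i j = sum (λ k → M i k * N k j)

  _•_ : Carrier → Matrix → Matrix
  (a • M) i j = a * M i j

  I : Matrix
  I i j = if does (i Finₚ.≟ j) then 1# else 0#

  E : ℕ → ℕ → Matrix
  E i j a b = if does (label a ℕₚ.≟ i ×-dec label b ℕₚ.≟ j) then 1# else 0#

  ∏ : List Matrix → Matrix
  ∏ = List.foldr _·_ I

  open Algebra.Definitions _≋_ public using (Invertible)

  infix 4 _IsInverseOf_
  _IsInverseOf_ : Matrix → Matrix → Set ℓ
  X IsInverseOf M = (X · M ≋ I) × (M · X ≋ I)

  -- The entry with labels (i , j); 0 for labels outside 1,…,n.
  entry : Matrix → ℕ → ℕ → Carrier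
  entry M (suc i) (suc j) with i ℕₚ.<? n | j ℕₚ.<? n
  ... | yes i<n | yes j<n = M (fromℕ< i<n) (fromℕ< j<n)
  ... | _       | _       = 0#
  entry M _ _ = 0#

  listSum : List Carrier → Carrier
  listSum = List.foldr _+_ 0#

-- m_α for 1 ≤ α ≤ r.  The value 0 elsewhere is arbitrary; nothing below
-- depends on it when R is a solution of the Q-system, because then
-- λ_{0,n} = λ_{r+1,n} = 1.
at : ∀ {r} → Vector ℤ r → ℕ → ℤ
at m zero = 0ℤ
at {r} m (suc k) with k ℕₚ.<? r
... | yes k<r = m (fromℕ< k<r)
... | no  _   = 0ℤ

record IsMotzkin {r : ℕ} (m : Vector ℤ r) : Set where
  field
    step     : ∀ α → 1 ≤ α → α < r → ℤ.∣ at m α ℤ.- at m (suc α) ∣ ≤ 1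
    min≥0    : ∀ i → 0ℤ ℤ.≤ m i
    attained : ∃[ i ] m i ≡ 0ℤ

-- s = 1 for ascending and s = -1 for descending segments.
module _ {r : ℕ} (s : ℤ) (m : Vector ℤ r) where

  record IsSegment (α β : ℕ) : Set where
    constructor segment
    field
      1≤α    : 1 ≤ α
      α<β    : α < β
      β≤r    : β ≤ r
      linear : ∀ j → j ≤ β ∸ α → at m (α ℕ.+ j) ≡ at m α ℤ.+ s ℤ.* (+ j)

  record IsMaximalSegment (α β : ℕ) : Set where
    constructor maximalSegment
    field
      isSegment : IsSegment α β
      maximal   : ∀ α′ β′ → IsSegment α′ β′ → α′ ≤ α → β ≤ β′ → α′ ≡ α × β′ ≡ β

  isSegment? : ∀ α β → Dec (IsSegment α β)
  isSegment? α β = map′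
    (λ (p , q , u , l) → segment p q u (λ _ j≤ → l (s≤s j≤)))
    (λ (segment p q u l) → p , q , u , λ {j} j< → l j (ℕₚ.≤-pred j<))
    (1 ℕₚ.≤? α ×-dec α ℕₚ.<? β ×-dec β ℕₚ.≤? r ×-dec
      ℕₚ.allUpTo? (λ j → at m (α ℕ.+ j) ℤₚ.≟ at m α ℤ.+ s ℤ.* (+ j)) (suc (β ∸ α)))

  private
    Nested : ℕ → ℕ → ℕ → ℕ → Set
    Nested α β α′ β′ = IsSegment α′ β′ → β ≤ β′ → α′ ≡ α × β′ ≡ β

    nested? : ∀ α β α′ β′ → Dec (Nested α β α′ β′)
    nested? α β α′ β′ with isSegment? α′ β′ | β ℕₚ.≤? β′ | α′ ℕₚ.≟ α ×-dec β′ ℕₚ.≟ β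
    ... | no ¬p | _     | _     = yes λ p _ → contradiction p ¬p
    ... | yes _ | no ¬q | _     = yes λ _ q → contradiction q ¬q
    ... | yes _ | yes _ | yes e = yes λ _ _ → e
    ... | yes p | yes q | no ¬e = no λ f → ¬e (f p q)

  isMaximalSegment? : ∀ α β → Dec (IsMaximalSegment α β)
  isMaximalSegment? α β = map′
    (λ (p , f) → maximalSegment p λ _ _ p′ α′≤α β≤β′ →
       f (s≤s α′≤α) (s≤s (IsSegment.β≤r p′)) p′ β≤β′)
    (λ (maximalSegment p f) → p , λ {α′} α′< {β′} _ p′ β≤β′ → f α′ β′ p′ (ℕₚ.≤-pred α′<) β≤β′)
    (isSegment? α β ×-dec
      ℕₚ.allUpTo? (λ α′ → ℕₚ.allUpTo? (nested? α β α′) (suc r)) (suc α))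

  -- Lexicographic enumeration lists the (disjoint) segments from left to right.
  maximalSegments : List (ℕ × ℕ)
  maximalSegments =
    List.filter (λ (α , β) → isMaximalSegment? α β) (cartesianProduct [ 1 ⋯ r ] [ 1 ⋯ r ])

ascents descents : ∀ {r} → Vector ℤ r → List (ℕ × ℕ)
ascents  = maximalSegments 1ℤ
descents = maximalSegments -1ℤ

-- In (r,…,1), and also after other disjoint blocks have been reversed, the
-- block (β,…,α) occupies the positions r-β,…,r-α, counted from 0.
reverseBlock : ℕ → List ℕ → ℕ × ℕ → List ℕ
reverseBlock r xs (α , β) =
  List.take (r ∸ β) xs
    List.++ List.reverse (List.take (suc β ∸ α) (List.drop (r ∸ β) xs))
    List.++ List.drop (suc r ∸ α) xs

σ τ : ∀ {r} → Vector ℤ r → List ℕ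
σ {r} m = List.foldl (reverseBlock r) (applyDownFrom suc r) (ascents m)
τ {r} m = List.foldl (reverseBlock r) (applyDownFrom suc r) (descents m)

module _ (K : Field c ℓ) (r : ℕ) where
  open Field K

  -- Only the rows R α with α ≤ r + 1 matter.
  record IsQSystem (R : ℕ → ℤ → Carrier) : Set ℓ where
    field
      relation : ∀ α n → 1 ≤ α → α ≤ r →
        R α (n ℤ.+ 1ℤ) * R α (n ℤ.- 1ℤ) ≈ R α n * R α n + R (suc α) n * R (pred α) n
      lower    : ∀ n → R 0 n ≈ 1#
      upper    : ∀ n → R (suc r) n ≈ 1#

  initialData : (ℕ → ℤ → Carrier) → Vector Carrier (r ℕ.+ r)
  initialData R = (λ (i : Fin r) → R (label i) 0ℤ) ++ (λ (i : Fin r) → R (label i) 1ℤ)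

module Compactified (K : Field c ℓ) {r : ℕ} (m : Vector ℤ r) (R : ℕ → ℤ → Field.Carrier K) where
  open Field K using (Carrier; _/_; _*_; 1#; _≈_)

  lam μ : ℕ → ℤ → Carrier
  lam α n = R α (n ℤ.+ 1ℤ) / R α n
  μ   α n = R α n / R (pred α) n

  -- yOdd α = y_{2α-1} and yEven α = y_{2α}.
  yOdd yEven A B : ℕ → Carrier

  yOdd α = lam α (at m α) / lam (pred α) (at m (pred α))

  yEven α = μ (suc α) (at m α ℤ.+ 1ℤ) / μ α (at m α) * A α * B α

  A α = if does (at m α ℤₚ.≟ at m (suc α) ℤ.+ 1ℤ)
        then lam (suc α) (at m (suc α)) / lam (suc α) (at m α)
        else 1#

  B α = if does (at m (pred α) ℤₚ.≟ at m α ℤ.+ 1ℤ)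
        then lam (pred α) (at m α) / lam (pred α) (at m (pred α))
        else 1#

  fieldProduct : List Carrier → Carrier
  fieldProduct = List.foldr _*_ 1#

  open PowerSeries (Field.rawRing K) public using (Series; const; t)
  seriesRing : RawRing _ _
  seriesRing = PowerSeries.rawRing (Field.rawRing K)

  open RawRing seriesRing public using () renaming (_≈_ to _≈ₛ_; _+_ to _+ₛ_)
  private
    module S = RawRing seriesRing
  open RawSemiringDefs S.rawSemiring using (_^_)
  open Matrices seriesRing (suc r) public

  Vertex : Set
  Vertex = Fin (suc r)

  data Edge (a b : Vertex) : Set where
    up   : label b ≡ suc (label a) → Edge a b
    down : label a ≡ suc (label b) → Edge a b
    loop : a ≡ b → Edge a b
    desc : ∀ α β p q → (α , β) ∈ descents m → q ℕ.+ 2 ≤ p → α ℕ.+ p ≤ suc β →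
           label a ≡ α ℕ.+ p → label b ≡ α ℕ.+ q → Edge a b
    asc  : ∀ α β p q → (α , β) ∈ ascents m → q ℕ.+ 2 ≤ p → α ℕ.+ p ≤ suc β →
           label a ≡ α ℕ.+ q → label b ≡ α ℕ.+ p → Edge a b

  weight : ∀ {a b} → Edge a b → Series
  weight         (up _)   = S.1#
  weight {b = b} (down _) = t S.* const (yEven (label b))
  weight {a = a} (loop _) = t S.* const (yOdd (label a))
  weight (desc α β p q _ _ _ _ _) = t S.* const
    ( fieldProduct (List.map yEven [ α ℕ.+ q ⋯ α ℕ.+ p ∸ 1 ])
    / fieldProduct (List.map yOdd  [ α ℕ.+ q ℕ.+ 1 ⋯ α ℕ.+ p ∸ 1 ]))
  weight (asc α β p q _ _ _ _ _) = (S.- S.1#) ^ (p ∸ q ∸ 1)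

  private
    Covers : ℕ → ℕ → ℕ × ℕ → Set
    Covers u v (α , β) = α ≤ u × u ℕ.+ 2 ≤ v × v ≤ suc β

    covers? : ∀ u v (segs : List (ℕ × ℕ)) → Dec (Any (Covers u v) segs)
    covers? u v = any? (λ (α , β) → α ℕₚ.≤? u ×-dec u ℕ.+ 2 ℕₚ.≤? v ×-dec v ℕₚ.≤? suc β)

    Offsets : ℕ → ℕ → List (ℕ × ℕ) → Set
    Offsets u v segs = ∃[ α ] ∃[ β ] ∃[ p ] ∃[ q ]
      (α , β) ∈ segs × q ℕ.+ 2 ≤ p × α ℕ.+ p ≤ suc β × v ≡ α ℕ.+ p × u ≡ α ℕ.+ q

    offsets? : ∀ u v segs → Dec (Offsets u v segs)
    offsets? u v segs = map′ to from (covers? u v segs)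
      where
      to : Any (Covers u v) segs → Offsets u v segs
      to any with find any
      ... | (α , β) , mem , α≤u , u+2≤v , v≤β+1 =
        α , β , v ∸ α , u ∸ α , mem
        , ℕₚ.+-cancelˡ-≤ α _ _ (subst₂ _≤_
            (trans (cong (ℕ._+ 2) (sym (ℕₚ.m+[n∸m]≡n α≤u))) (ℕₚ.+-assoc α (u ∸ α) 2))
            (sym α+p) u+2≤v)
        , subst (_≤ suc β) (sym α+p) v≤β+1
        , sym α+p
        , sym (ℕₚ.m+[n∸m]≡n α≤u)
        where
        α+p : α ℕ.+ (v ∸ α) ≡ v
        α+p = ℕₚ.m+[n∸m]≡n (ℕₚ.≤-trans α≤u (ℕₚ.≤-trans (ℕₚ.m≤m+n u 2) u+2≤v))
      from : Offsets u v segs → Any (Covers u v) segs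
      from (α , β , p , q , mem , q+2≤p , le , refl , refl) = lose mem
        ( ℕₚ.m≤m+n α q
        , subst (_≤ α ℕ.+ p) (sym (ℕₚ.+-assoc α q 2)) (ℕₚ.+-monoʳ-≤ α q+2≤p)
        , le)

  edge? : ∀ a b → Dec (Edge a b)
  edge? a b with label b ℕₚ.≟ suc (label a) | label a ℕₚ.≟ suc (label b) | a Finₚ.≟ b
               | offsets? (label b) (label a) (descents m)
               | offsets? (label a) (label b) (ascents m)
  ... | yes e | _     | _     | _     | _ = yes (up e)
  ... | no _  | yes e | _     | _     | _ = yes (down e)
  ... | no _  | no _  | yes e | _     | _ = yes (loop e)
  ... | no _  | no _  | no _  | yes (α , β , p , q , x , y , z , u , v) | _ =
        yes (desc α β p q x y z u v)
  ... | no _  | no _  | no _  | no _  | yes (α , β , p , q , x , y , z , v , u) =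
        yes (asc α β p q x y z u v)
  ... | no ¬u | no ¬d | no ¬l | no ¬x | no ¬y = no λ
        { (up e) → ¬u e
        ; (down e) → ¬d e
        ; (loop e) → ¬l e
        ; (desc α β p q x y z u v) → ¬x (α , β , p , q , x , y , z , u , v)
        ; (asc α β p q x y z u v)  → ¬y (α , β , p , q , x , y , z , v , u) }

  -- Row b, column a holds the weight of a → b.  Distinct maximal segments of
  -- one kind are disjoint, so the weight does not depend on the edge found.
  T′ : Matrix
  T′ b a with edge? a b
  ... | yes e = weight e
  ... | no _  = S.0#

  f d e : ℕ → Matrix
  f i = I ⊕ E (suc i) i
  d i = I ⊕ (const (yOdd i) S.+ S.- S.1#) • E i i
  e i = I ⊕ const (yEven i / yOdd i) • E i (suc i)

  F D U P : Matrix
  F = ∏ (List.map f (σ m))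
  D = ∏ (List.map d [ 1 ⋯ suc r ])
  U = ∏ (List.map e (τ m))
  P = F · D · U

  firstRowSum : Matrix → ℕ → ℕ → Series
  firstRowSum M lo hi = listSum (List.map (entry M 1) [ lo ⋯ hi ])

{-# OPTIONS --safe #-}
module Submission where

-- A product of transvections I + x_i E_{i,i+1} over a list without repetitions
-- has (b , a) entry x_b ⋯ x_{a-1} if b, …, a-1 occur in this order in the list,
-- and 0 otherwise for b < a.  In σ (in τ) the number j precedes j + 1 exactly if
-- both lie in one ascending (descending) segment, because the maximal segments
-- of one kind are disjoint and each is reversed as a block.  Hence the
-- off-diagonal entries of F⁻¹ and of D U match the edges of the graph one by one,
-- which gives T′ + F⁻¹ = I + t D U, that is F (I − T′) = I − t P.
-- The quotients y_{2i}/y_{2i-1} make sense because every R_{α,n} with n ≥ 0 is a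
-- quotient of nonempty sums of monomials in the initial data, which do not
-- vanish by algebraic independence.

open import Defs
open import Algebra.Bundles using (CommutativeRing)
open import Algebra.Bundles.Raw using (RawRing)
import Algebra.Definitions.RawSemiring as RawSemiringDefs
import Algebra.Properties.AbelianGroup as AbelianGroupProperties
import Algebra.Properties.CommutativeMonoid.Sum as CommutativeMonoidSum
import Algebra.Properties.CommutativeSemigroup as CommutativeSemigroupProperties
import Algebra.Properties.Ring as RingProperties
import Algebra.Properties.Semiring.Exp as SemiringExp
import Algebra.Properties.Semiring.Sum as SemiringSum
open import Data.Bool.Base using (Bool; true; false; if_then_else_; _∧_)
open import Data.Fin.Base using (Fin; zero; suc; toℕ; fromℕ<; _↑ˡ_; _↑ʳ_)
import Data.Fin.Properties as Finₚ
open import Data.Integer.Base as ℤ using (ℤ; 0ℤ; 1ℤ; -1ℤ; +≤+) renaming (+_ to pos)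
import Data.Integer.Properties as ℤₚ
import Data.Integer.Tactic.RingSolver as ℤSolver
open import Data.List.Base
  using (List; []; _∷_; _++_; _∷ʳ_; map; reverse; foldl; foldr; iterate; take; drop; length; lookup; head;
         applyUpTo; applyDownFrom; cartesianProduct; cartesianProductWith)
open import Data.List.Membership.Propositional using (_∈_; _∉_; find; lose)
open import Data.List.Membership.Propositional.Properties
  using (∈-applyDownFrom⁺; ∈-applyUpTo⁺; ∈-map⁺; ∈-lookup)
open import Data.List.Properties
  using (++-assoc; ++-identityʳ; length-applyDownFrom; reverse-applyDownFrom; reverse-map; unfold-reverse)
open import Data.List.Relation.Binary.Permutation.Propositional
  using (_↭_; ↭-refl; ↭-trans; ↭-sym; ↭-reflexive; ↭⇒↭ₛ)
import Data.List.Relation.Binary.Permutation.Propositional.Properties as ↭ₚ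
import Data.List.Relation.Binary.Permutation.Setoid.Properties as ↭ₛₚ
open import Data.List.Relation.Binary.Sublist.Propositional
  using (_⊆_; from∈; minimum; ⊆-refl; ⊆-trans)
  renaming (_∷_ to _∷ₛ_; _∷ʳ_ to _∷ʳₛ_; lookup to ⊆-lookup)
open import Data.List.Relation.Binary.Sublist.Propositional.Properties
  using (reverse⁺) renaming (++⁺ to ⊆-++⁺; ++⁺ˡ to ⊆-++⁺ˡ; ++⁺ʳ to ⊆-++⁺ʳ)
open import Data.List.Relation.Unary.All as All using (All; []; _∷_)
import Data.List.Relation.Unary.All.Properties as Allₚ
open import Data.List.Relation.Unary.AllPairs as AllPairs using (AllPairs; []; _∷_)
import Data.List.Relation.Unary.AllPairs.Properties as AllPairsₚ
open import Data.List.Relation.Unary.Any using (here; there; any?)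
open import Data.List.Relation.Unary.Unique.Propositional using (Unique)
open import Data.List.Relation.Unary.Unique.Propositional.Properties
  using (Unique[x∷xs]⇒x∉xs) renaming (applyDownFrom⁺₁ to unique-applyDownFrom⁺)
open import Data.Maybe.Base using (just; nothing)
open import Data.Nat.Base as ℕ using (ℕ; zero; suc; _∸_; _≤_; _<_; z≤n; s≤s)
import Data.Nat.Properties as ℕₚ
open import Data.Nat.Tactic.RingSolver using (solve-∀)
open import Data.Product.Base using (_×_; _,_; proj₁; proj₂; ∃-syntax)
open import Data.Sum.Base using (_⊎_; inj₁; inj₂; [_,_]′)
open import Data.Vec.Base as Vec using (Vec)
open import Data.Vec.Functional using (Vector)
open import Data.Vec.Functional.Properties using (lookup-++ˡ; lookup-++ʳ)
import Data.Vec.Properties as Vecₚ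
open import Function.Base using (_∘_)
open import Function.Definitions using (Injective)
open import Level using (Level)
open import Relation.Binary.Core using (Rel)
open import Relation.Binary.Definitions using (Tri; tri<; tri≈; tri>)
open import Relation.Binary.PropositionalEquality using (_≡_; _≢_)
import Relation.Binary.PropositionalEquality as ≡
import Relation.Binary.Reasoning.Setoid as SetoidReasoning
open import Relation.Nullary.Decidable using (Dec; yes; no; does; _×-dec_)
open import Relation.Nullary.Negation using (¬_; contradiction)

-- Letters and vertices are offset by one: an entry linking vertices b < a uses the letters b, ...,
-- a - 1, so a segment [α, β] of letters joins vertices up to β + 1. This is the origin of the bound
-- `suc β` in the edges.
--
-- In the entrywise identity `F⁻¹` is lower and `D · U` upper triangular, so an edge off the
-- diagonal meets only one of them. `F⁻¹` multiplies the matrices I - E in the opposite order, and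
-- each letter contributes -1: hence the signs of the ascending edges. In `D · U` the scaling of row
-- b by y_{2b-1} cancels the first denominator coming from `U`. Since the inverse of 0 in K is
-- unspecified, this cancellation is where nonvanishing enters.
--
-- The first row depends on column 1 of `F`, whose entry in row b is 1 if b - 1, ..., 1 occur in
-- this order in `σ`, and 0 otherwise. If a₁ starts the first ascent, the order persists down from
-- a₁ but a₁ precedes a₁ + 1, so the ones fill the rows 1, ..., a₁ + 1. This gives the upper limit
-- of the sum, which equals 2 for a₁ = 1. Without ascents the whole column consists of ones.

private
  variable
    a p c ℓ ℓ′ : Level
    X : Set a

-- Asking for Q at every edge, not only at the one that `edge?` selects, makes that selection
-- irrelevant, and the `with` inside `T′` is unfolded only here.
T′-cases : ∀ (K : Field c ℓ) {r} (m : Vector ℤ r) (R : ℕ → ℤ → Field.Carrier K) →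
  let open Compactified K m R in
  (Q : Series → Set p) → ∀ b a →
  (∀ (e : Edge a b) → Q (weight e)) → (¬ Edge a b → Q (RawRing.0# seriesRing)) → Q (T′ b a)
T′-cases K m R Q b a edge noEdge with Compactified.edge? K m R a b
... | yes e = edge e
... | no ¬e = noEdge ¬e

-- Power series and matrices

module SeriesProperties (A : CommutativeRing c ℓ) where
  open CommutativeRing A hiding (rawRing)
  open PowerSeries (CommutativeRing.rawRing A)
  open SemiringSum semiring
  open SetoidReasoning setoid
  open CommutativeSemigroupProperties (CommutativeRing.+-commutativeSemigroup A) using (x∙yz≈y∙xz)
  private module S = RawRing rawRing

  -- The product unfolds definitionally as (f g)(n + 1) = f(0) g(n + 1) + (shift f · g)(n), so the
  -- ring laws follow by induction on the exponent with f replaced by `shift f`.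
  shift : Series → Series
  shift f = f ∘ suc

  const-0 : ∀ n → const 0# n ≈ 0#
  const-0 zero    = refl
  const-0 (suc n) = refl

  conv-cong : ∀ {f f′ g g′} → f S.≈ f′ → g S.≈ g′ → (f S.* g) S.≈ (f′ S.* g′)
  conv-cong {f} {f′} {g} {g′} p q n = sum-cong-≋ {suc n} (λ k → *-cong (p (toℕ k)) (q (n ∸ toℕ k)))

  sum-linearˡ : ∀ {N} x (u v w : Fin N → Carrier) →
    sum (λ k → (x * u k + v k) * w k) ≈ x * sum (λ k → u k * w k) + sum (λ k → v k * w k)
  sum-linearˡ {N} x u v w = begin
    sum (λ k → (x * u k + v k) * w k)
      ≈⟨ sum-cong-≋ {N} (λ k → trans (distribʳ _ _ _) (+-congʳ (*-assoc _ _ _))) ⟩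
    sum (λ k → x * (u k * w k) + v k * w k)
      ≈⟨ ∑-distrib-+ (λ k → x * (u k * w k)) (λ k → v k * w k) ⟩
    sum (λ k → x * (u k * w k)) + sum (λ k → v k * w k)
      ≈⟨ +-congʳ (*-distribˡ-sum x (λ k → u k * w k)) ⟨
    x * sum (λ k → u k * w k) + sum (λ k → v k * w k) ∎

  -- Shaped after the shift of a product, which is f(0) · shift g + shift f · g; this is what
  -- associativity meets in its inductive step.
  conv-linearˡ : ∀ x f g h n →
    ((λ k → x * f k + g k) S.* h) n ≈ x * (f S.* h) n + (g S.* h) n
  conv-linearˡ x f g h n =
    sum-linearˡ {suc n} x (f ∘ toℕ) (g ∘ toℕ) (λ k → h (n ∸ toℕ k))

  conv-assoc : ∀ f g h → ((f S.* g) S.* h) S.≈ (f S.* (g S.* h))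
  conv-assoc f g h zero = begin
    (f 0 * g 0 + 0#) * h 0 + 0#   ≈⟨ +-congʳ (*-congʳ (+-identityʳ _)) ⟩
    (f 0 * g 0) * h 0 + 0#        ≈⟨ +-congʳ (*-assoc _ _ _) ⟩
    f 0 * (g 0 * h 0) + 0#        ≈⟨ +-congʳ (*-congˡ (+-identityʳ _)) ⟨
    f 0 * (g 0 * h 0 + 0#) + 0#   ∎
  conv-assoc f g h (suc n) = begin
    (f 0 * g 0 + 0#) * h (suc n) + (shift (f S.* g) S.* h) n
      ≈⟨ +-cong (*-congʳ (+-identityʳ _)) (conv-linearˡ (f 0) (shift g) (shift f S.* g) h n) ⟩
    f 0 * g 0 * h (suc n) + (f 0 * (shift g S.* h) n + ((shift f S.* g) S.* h) n)
      ≈⟨ +-cong (*-assoc _ _ _) (+-congˡ (conv-assoc (shift f) g h n)) ⟩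
    f 0 * (g 0 * h (suc n)) + (f 0 * (shift g S.* h) n + (shift f S.* (g S.* h)) n)
      ≈⟨ +-assoc _ _ _ ⟨
    f 0 * (g 0 * h (suc n)) + f 0 * (shift g S.* h) n + (shift f S.* (g S.* h)) n
      ≈⟨ +-congʳ (distribˡ _ _ _) ⟨
    f 0 * (g S.* h) (suc n) + (shift f S.* (g S.* h)) n ∎

  -- Splits off the last term of the convolution, where the definition splits off the first.
  -- Commutativity is an induction that trades one for the other.
  conv-sucʳ : ∀ f g n → (f S.* g) (suc n) ≈ f (suc n) * g 0 + (f S.* shift g) n
  conv-sucʳ f g zero = x∙yz≈y∙xz _ _ _
  conv-sucʳ f g (suc n) =
    trans (+-congˡ (conv-sucʳ (shift f) g n)) (x∙yz≈y∙xz _ _ _)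

  conv-comm : ∀ f g → (f S.* g) S.≈ (g S.* f)
  conv-comm f g zero = +-congʳ (*-comm _ _)
  conv-comm f g (suc n) = begin
    f 0 * g (suc n) + (shift f S.* g) n ≈⟨ +-cong (*-comm _ _) (conv-comm (shift f) g n) ⟩
    g (suc n) * f 0 + (g S.* shift f) n ≈⟨ conv-sucʳ g f n ⟨
    (g S.* f) (suc n) ∎

  conv-zeroˡ : ∀ f n → ((λ _ → 0#) S.* f) n ≈ 0#
  conv-zeroˡ f n = trans (sum-cong-≋ {suc n} (λ k → zeroˡ (f (n ∸ toℕ k)))) (sum-replicate-zero (suc n))

  const-* : ∀ a f n → (const a S.* f) n ≈ a * f n
  const-* a f zero    = +-identityʳ _
  const-* a f (suc n) = trans (+-congˡ (conv-zeroˡ f n)) (+-identityʳ _)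

  conv-identityˡ : ∀ f → (const 1# S.* f) S.≈ f
  conv-identityˡ f n = trans (const-* 1# f n) (*-identityˡ _)

  t-*-zero : ∀ f → (t S.* f) 0 ≈ 0#
  t-*-zero f = trans (+-identityʳ _) (zeroˡ _)

  t-*-suc : ∀ f n → (t S.* f) (suc n) ≈ f n
  t-*-suc f n = begin
    0# * f (suc n) + (shift t S.* f) n ≈⟨ +-cong (zeroˡ _) (conv-cong {shift t} {const 1#} {f} {f} shift-t (λ _ → refl) n) ⟩
    0# + (const 1# S.* f) n            ≈⟨ +-identityˡ _ ⟩
    (const 1# S.* f) n                 ≈⟨ conv-identityˡ f n ⟩
    f n ∎
    where
    shift-t : shift t S.≈ const 1#
    shift-t zero    = refl
    shift-t (suc _) = refl

  conv-distribˡ : ∀ f g h → (f S.* (g S.+ h)) S.≈ ((f S.* g) S.+ (f S.* h))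
  conv-distribˡ f g h n =
    trans (sum-cong-≋ {suc n} (λ k → distribˡ (f (toℕ k)) (g (n ∸ toℕ k)) (h (n ∸ toℕ k))))
          (∑-distrib-+ {suc n} (λ k → f (toℕ k) * g (n ∸ toℕ k)) (λ k → f (toℕ k) * h (n ∸ toℕ k)))

  seriesCommutativeRing : CommutativeRing _ _
  seriesCommutativeRing = record
    { Carrier = Series
    ; _≈_ = S._≈_ ; _+_ = S._+_ ; _*_ = S._*_ ; -_ = S.-_ ; 0# = S.0# ; 1# = S.1#
    ; isCommutativeRing = record
      { isRing = record
        { +-isAbelianGroup = record
          { isGroup = record
            { isMonoid = record
              { isSemigroup = record
                { isMagma = record
                  { isEquivalence = record
                    { refl = λ _ → refl ; sym = λ p n → sym (p n) ; trans = λ p q n → trans (p n) (q n) }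
                  ; ∙-cong = λ p q n → +-cong (p n) (q n) }
                ; assoc = λ f g h n → +-assoc _ _ _ }
              ; identity = (λ f n → trans (+-congʳ (const-0 n)) (+-identityˡ _))
                         , (λ f n → trans (+-congˡ (const-0 n)) (+-identityʳ _)) }
            ; inverse = (λ f n → trans (-‿inverseˡ _) (sym (const-0 n)))
                      , (λ f n → trans (-‿inverseʳ _) (sym (const-0 n)))
            ; ⁻¹-cong = λ p n → -‿cong (p n) }
          ; comm = λ f g n → +-comm _ _ }
        ; *-cong = conv-cong
        ; *-assoc = conv-assoc
        ; *-identity = conv-identityˡ , λ f n → trans (conv-comm f (const 1#) n) (conv-identityˡ f n)
        ; distrib = conv-distribˡ , λ f g h n →
            trans (conv-comm (g S.+ h) f n)
              (trans (conv-distribˡ f g h n) (+-cong (conv-comm f g n) (conv-comm f h n)))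
        }
      ; *-comm = conv-comm
      }
    }

module MatrixProperties (A : CommutativeRing c ℓ) (n : ℕ) where
  open CommutativeRing A
  open Matrices rawRing n
  open SemiringSum semiring
  open RingProperties ring using (-‿distribˡ-*; -‿distribʳ-*; -0#≈0#)
  open SetoidReasoning setoid

  ⟦_⟧ : Bool → Carrier
  ⟦ b ⟧ = if b then 1# else 0#

  -- On numbers, not on `Fin n`: the indices of `E` are arbitrary numbers and may exceed n. Deciding
  -- equality of numbers computes to `≡ᵇ`, so entries of `E` unfold to products of such symbols.
  δ : ℕ → ℕ → Carrier
  δ i j = ⟦ i ℕ.≡ᵇ j ⟧

  I≈δ : ∀ a b → I a b ≈ δ (label a) (label b)
  I≈δ a b = reflexive (≡.cong ⟦_⟧ (does-≟ a b))
    where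
    does-≟ : ∀ {n} (a b : Fin n) → does (a Finₚ.≟ b) ≡ (toℕ a ℕ.≡ᵇ toℕ b)
    does-≟ zero    zero    = ≡.refl
    does-≟ zero    (suc _) = ≡.refl
    does-≟ (suc _) zero    = ≡.refl
    does-≟ (suc a) (suc b) = does-≟ a b

  -- The vanishing hypothesis covers the indices j that the sum does not reach.
  sum-δ : ∀ {n} j (g : ℕ → Carrier) → (n ≤ j → g j ≈ 0#) →
    sum {n} (λ k → δ (toℕ k) j * g (toℕ k)) ≈ g j
  sum-δ {zero}  j g out = sym (out z≤n)
  sum-δ {suc n} zero g out = begin
    1# * g 0 + sum {n} (λ k → 0# * g (suc (toℕ k)))
      ≈⟨ +-cong (*-identityˡ _) (trans (sum-cong-≋ {n} (λ _ → zeroˡ _)) (sum-replicate-zero n)) ⟩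
    g 0 + 0# ≈⟨ +-identityʳ _ ⟩
    g 0 ∎
  sum-δ {suc n} (suc j) g out = begin
    0# * g 0 + sum {n} (λ k → δ (toℕ k) j * g (suc (toℕ k)))
      ≈⟨ +-cong (zeroˡ _) (sum-δ {n} j (g ∘ suc) (out ∘ s≤s)) ⟩
    0# + g (suc j) ≈⟨ +-identityˡ _ ⟩
    g (suc j) ∎

  ≋-refl : ∀ {M} → M ≋ M
  ≋-refl _ _ = refl

  ≋-sym : ∀ {M N} → M ≋ N → N ≋ M
  ≋-sym p a b = sym (p a b)

  ≋-trans : ∀ {L M N} → L ≋ M → M ≋ N → L ≋ N
  ≋-trans p q a b = trans (p a b) (q a b)

  ·-cong : ∀ {M M′ N N′} → M ≋ M′ → N ≋ N′ → M · N ≋ M′ · N′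
  ·-cong p q a b = sum-cong-≋ {n} (λ k → *-cong (p a k) (q k b))

  ·-assoc : ∀ L M N → (L · M) · N ≋ L · (M · N)
  ·-assoc L M N a b = begin
    sum {n} (λ k → sum {n} (λ j → L a j * M j k) * N k b)
      ≈⟨ sum-cong-≋ {n} (λ k → *-distribʳ-sum {n} (N k b) _) ⟩
    sum {n} (λ k → sum {n} (λ j → L a j * M j k * N k b))
      ≈⟨ ∑-comm {n} {n} _ ⟩
    sum {n} (λ j → sum {n} (λ k → L a j * M j k * N k b))
      ≈⟨ sum-cong-≋ {n} (λ j → sum-cong-≋ {n} (λ k → *-assoc _ _ _)) ⟩
    sum {n} (λ j → sum {n} (λ k → L a j * (M j k * N k b)))
      ≈⟨ sum-cong-≋ {n} (λ j → *-distribˡ-sum {n} (L a j) _) ⟨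
    sum {n} (λ j → L a j * sum {n} (λ k → M j k * N k b)) ∎

  private
    sum-I : ∀ {n} (a : Fin n) (g : Fin n → Carrier) →
      sum {n} (λ k → (if does (a Finₚ.≟ k) then 1# else 0#) * g k) ≈ g a
    sum-I {suc n} zero g = trans
      (+-cong (*-identityˡ _) (trans (sum-cong-≋ {n} (λ _ → zeroˡ _)) (sum-replicate-zero n)))
      (+-identityʳ _)
    sum-I {suc n} (suc a) g =
      trans (+-cong (zeroˡ _) (sum-I {n} a (g ∘ suc))) (+-identityˡ _)

    sum-I′ : ∀ {n} (a : Fin n) (g : Fin n → Carrier) →
      sum {n} (λ k → (if does (k Finₚ.≟ a) then 1# else 0#) * g k) ≈ g a
    sum-I′ {suc n} zero g = trans
      (+-cong (*-identityˡ _) (trans (sum-cong-≋ {n} (λ _ → zeroˡ _)) (sum-replicate-zero n)))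
      (+-identityʳ _)
    sum-I′ {suc n} (suc a) g =
      trans (+-cong (zeroˡ _) (sum-I′ {n} a (g ∘ suc))) (+-identityˡ _)

  ·-identityˡ : ∀ M → I · M ≋ M
  ·-identityˡ M a b = sum-I a (λ k → M k b)

  ·-identityʳ : ∀ M → M · I ≋ M
  ·-identityʳ M a b = trans (sum-cong-≋ {n} (λ _ → *-comm _ _)) (sum-I′ b (M a))

  ·-distribˡ-⊕ : ∀ L M N → L · (M ⊕ N) ≋ L · M ⊕ L · N
  ·-distribˡ-⊕ L M N a b = trans (sum-cong-≋ {n} (λ _ → distribˡ _ _ _)) (∑-distrib-+ {n} _ _)

  ·-distribʳ-⊕ : ∀ L M N → (M ⊕ N) · L ≋ M · L ⊕ N · L
  ·-distribʳ-⊕ L M N a b = trans (sum-cong-≋ {n} (λ _ → distribʳ _ _ _)) (∑-distrib-+ {n} _ _)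

  sum-neg : ∀ {n} (g : Fin n → Carrier) → sum {n} (λ k → - g k) ≈ - sum {n} g
  sum-neg {zero}  g = sym -0#≈0#
  sum-neg {suc n} g = trans (+-congˡ (sum-neg {n} (g ∘ suc))) (⁻¹-∙-comm _ _)
    where open AbelianGroupProperties +-abelianGroup using (⁻¹-∙-comm)

  ·-distribˡ-⊖ : ∀ L M N → L · (M ⊖ N) ≋ L · M ⊖ L · N
  ·-distribˡ-⊖ L M N a b = trans (·-distribˡ-⊕ L M (λ i j → - N i j) a b)
    (+-congˡ (trans (sum-cong-≋ {n} (λ _ → sym (-‿distribʳ-* _ _))) (sum-neg {n} _)))

  ·-distribʳ-⊖ : ∀ L M N → (M ⊖ N) · L ≋ M · L ⊖ N · L
  ·-distribʳ-⊖ L M N a b = trans (·-distribʳ-⊕ L M (λ i j → - N i j) a b)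
    (+-congˡ (trans (sum-cong-≋ {n} (λ _ → sym (-‿distribˡ-* _ _))) (sum-neg {n} _)))

  •-·ʳ : ∀ x M N → M · (x • N) ≋ x • (M · N)
  •-·ʳ x M N a b = trans (sum-cong-≋ {n} (λ _ → x∙yz≈y∙xz _ _ _)) (sym (*-distribˡ-sum {n} x _))
    where open CommutativeSemigroupProperties *-commutativeSemigroup using (x∙yz≈y∙xz)

  •-·ˡ : ∀ x M N → (x • M) · N ≋ x • (M · N)
  •-·ˡ x M N a b = trans (sum-cong-≋ {n} (λ _ → *-assoc _ _ _)) (sym (*-distribˡ-sum {n} x _))

  •-cong : ∀ x {M N} → M ≋ N → x • M ≋ x • N
  •-cong x p a b = *-congˡ (p a b)

  ⊖-cong : ∀ {M M′ N N′} → M ≋ M′ → N ≋ N′ → M ⊖ N ≋ M′ ⊖ N′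
  ⊖-cong p q a b = +-cong (p a b) (-‿cong (q a b))

-- Geometric series of a matrix that is constant in t

module ConstantMatrices (A : CommutativeRing c ℓ) (n : ℕ) where
  open CommutativeRing A hiding (rawRing; zero)
  open PowerSeries (CommutativeRing.rawRing A)
  open SeriesProperties A
  open SemiringSum semiring using (sum; sum-cong-≋)
  open RingProperties ring using (-0#≈0#)
  open SetoidReasoning setoid
  open Matrices rawRing n
  private
    module S = RawRing rawRing
    module A = Matrices (CommutativeRing.rawRing A) n
    module Aₚ = MatrixProperties A n
    module Sₚ = MatrixProperties seriesCommutativeRing n
    module Sum = SemiringSum (CommutativeRing.semiring seriesCommutativeRing)

  IsConstant : Series → Set _
  IsConstant f = ∀ k → f (suc k) ≈ 0#

  const-constant : ∀ x → IsConstant (const x)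
  const-constant x k = refl

  +-constant : ∀ {f g} → IsConstant f → IsConstant g → IsConstant (f S.+ g)
  +-constant f′ g′ k = trans (+-cong (f′ k) (g′ k)) (+-identityˡ _)

  neg-constant : ∀ {f} → IsConstant f → IsConstant (S.- f)
  neg-constant f′ k = trans (-‿cong (f′ k)) -0#≈0#

  constant-* : ∀ {f} → IsConstant f → ∀ g k → (f S.* g) k ≈ f 0 * g k
  constant-* {f} f′ g k = trans (conv-cong {f} {const (f 0)} {g} {g} f≈ (λ _ → refl) k) (const-* (f 0) g k)
    where
    f≈ : f S.≈ const (f 0)
    f≈ zero    = refl
    f≈ (suc k) = f′ k

  *-constant : ∀ {f g} → IsConstant f → IsConstant g → IsConstant (f S.* g)
  *-constant {f} {g} f′ g′ k = trans (constant-* {f} f′ g (suc k)) (trans (*-congˡ (g′ k)) (zeroʳ _))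

  sum-constant : ∀ {N} (f : Fin N → Series) → (∀ i → IsConstant (f i)) → IsConstant (Sum.sum f)
  sum-constant {zero}  f _  = const-constant 0#
  sum-constant {suc N} f f′ = +-constant {f zero} {Sum.sum (f ∘ suc)} (f′ zero) (sum-constant (f ∘ suc) (f′ ∘ suc))

  coefficient-sum : ∀ {N} (f : Fin N → Series) k → Sum.sum f k ≈ sum (λ i → f i k)
  coefficient-sum {zero}  f k = const-0 k
  coefficient-sum {suc N} f k = +-congˡ (coefficient-sum (f ∘ suc) k)

  IsConstantMatrix : Matrix → Set _
  IsConstantMatrix M = ∀ i j → IsConstant (M i j)

  ⟦⟧-constant : ∀ (b : Bool) → IsConstant (if b then S.1# else S.0#)
  ⟦⟧-constant true  k = refl
  ⟦⟧-constant false k = refl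

  I-constant : IsConstantMatrix I
  I-constant i j = ⟦⟧-constant (does (i Finₚ.≟ j))

  E-constant : ∀ p q → IsConstantMatrix (E p q)
  E-constant p q i j = ⟦⟧-constant (does (label i ℕₚ.≟ p ×-dec label j ℕₚ.≟ q))

  ⊕-constant : ∀ {M N} → IsConstantMatrix M → IsConstantMatrix N → IsConstantMatrix (M ⊕ N)
  ⊕-constant {M} {N} M′ N′ i j = +-constant {M i j} {N i j} (M′ i j) (N′ i j)

  •-constant : ∀ {f M} → IsConstant f → IsConstantMatrix M → IsConstantMatrix (f • M)
  •-constant {f} {M} f′ M′ i j = *-constant {f} {M i j} f′ (M′ i j)

  ·-constant : ∀ {M N} → IsConstantMatrix M → IsConstantMatrix N → IsConstantMatrix (M · N)
  ·-constant {M} {N} M′ N′ i j =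
    sum-constant {n} (λ k → M i k S.* N k j) (λ k → *-constant {M i k} {N k j} (M′ i k) (N′ k j))

  ∏-constant : ∀ {G : ℕ → Matrix} → (∀ i → IsConstantMatrix (G i)) → ∀ L → IsConstantMatrix (∏ (map G L))
  ∏-constant G′ []      = I-constant
  ∏-constant {G} G′ (i ∷ L) = ·-constant {G i} {∏ (map G L)} (G′ i) (∏-constant G′ L)

  module _ {M : Matrix} (M′ : IsConstantMatrix M) where
    private
      M₀ : A.Matrix
      M₀ i j = M i j 0

    power : ℕ → A.Matrix
    power zero    = A.I
    power (suc k) = M₀ A.· power k

    -- Powers grow on the left by definition; growth on the right is needed for the other half of
    -- the two-sided inverse.
    power-comm : ∀ k → (power k A.· M₀) A.≋ power (suc k)
    power-comm zero    = Aₚ.≋-trans (Aₚ.·-identityˡ M₀) (Aₚ.≋-sym (Aₚ.·-identityʳ M₀))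
    power-comm (suc k) = Aₚ.≋-trans (Aₚ.·-assoc M₀ (power k) M₀)
      (Aₚ.·-cong (Aₚ.≋-refl {M₀}) (power-comm k))

    -- For M free of t the inverse of I - tM is the sum of the t^k M^k, so its coefficients are
    -- powers over the base ring.
    geometric : Matrix
    geometric i j k = power k i j

    M·geometric : ∀ i j k → (M · geometric) i j k ≈ power (suc k) i j
    M·geometric i j k = trans (coefficient-sum {n} (λ l → M i l S.* geometric l j) k)
      (sum-cong-≋ {n} (λ l → constant-* {M i l} (M′ i l) (geometric l j) k))

    geometric·M : ∀ i j k → (geometric · M) i j k ≈ power (suc k) i j
    geometric·M i j k = begin
      (geometric · M) i j k
        ≈⟨ coefficient-sum {n} (λ l → geometric i l S.* M l j) k ⟩
      sum {n} (λ l → (geometric i l S.* M l j) k)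
        ≈⟨ sum-cong-≋ {n} (λ l → trans (conv-comm (geometric i l) (M l j) k)
             (trans (constant-* {M l j} (M′ l j) (geometric i l) k) (*-comm _ _))) ⟩
      (power k A.· M₀) i j
        ≈⟨ power-comm k i j ⟩
      power (suc k) i j ∎

    private
      -- Multiplication by t shifts the coefficients by one, so all coefficients beyond the constant
      -- one cancel.
      difference : ∀ {N} → (∀ i j k → N i j k ≈ power (suc k) i j) → geometric ⊖ t • N ≋ I
      difference {N} N≈ i j zero = begin
        A.I i j + - ((t S.* N i j) 0) ≈⟨ +-congˡ (trans (-‿cong (t-*-zero (N i j))) -0#≈0#) ⟩
        A.I i j + 0#                  ≈⟨ +-identityʳ _ ⟩
        A.I i j                       ≈⟨ I₀ (does (i Finₚ.≟ j)) ⟩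
        I i j 0 ∎
        where
        I₀ : ∀ b → (if b then 1# else 0#) ≈ (if b then S.1# else S.0#) 0
        I₀ true  = refl
        I₀ false = refl
      difference {N} N≈ i j (suc k) = begin
        power (suc k) i j + - ((t S.* N i j) (suc k))
          ≈⟨ +-congˡ (-‿cong (trans (t-*-suc (N i j) k) (N≈ i j k))) ⟩
        power (suc k) i j + - power (suc k) i j
          ≈⟨ -‿inverseʳ _ ⟩
        0#
          ≈⟨ I-constant i j k ⟨
        I i j (suc k) ∎

    geometric-inverse : geometric IsInverseOf (I ⊖ t • M)
    geometric-inverse =
        Sₚ.≋-trans (Sₚ.·-distribˡ-⊖ geometric I (t • M))
          (Sₚ.≋-trans (Sₚ.⊖-cong (Sₚ.·-identityʳ geometric) (Sₚ.•-·ʳ t geometric M))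
            (difference {geometric · M} geometric·M))
      , Sₚ.≋-trans (Sₚ.·-distribʳ-⊖ geometric I (t • M))
          (Sₚ.≋-trans (Sₚ.⊖-cong (Sₚ.·-identityˡ geometric) (Sₚ.•-·ˡ t M geometric))
            (difference {M · geometric} M·geometric))

-- Products of elementary matrices

module ElementaryMatrices (A : CommutativeRing c ℓ) (n : ℕ) where
  open CommutativeRing A
  open Matrices rawRing n
  open MatrixProperties A n
  open SemiringSum semiring
  open SetoidReasoning setoid

  ⟦∧⟧ : ∀ p q → ⟦ p ∧ q ⟧ ≈ ⟦ p ⟧ * ⟦ q ⟧
  ⟦∧⟧ true  q = sym (*-identityˡ _)
  ⟦∧⟧ false q = sym (zeroˡ _)

  δ-refl : ∀ i → δ i i ≈ 1#
  δ-refl zero    = refl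
  δ-refl (suc i) = δ-refl i

  δ-≢ : ∀ {i j} → i ≢ j → δ i j ≈ 0#
  δ-≢ {zero}  {zero}  i≢j = contradiction ≡.refl i≢j
  δ-≢ {zero}  {suc _} _   = refl
  δ-≢ {suc _} {zero}  _   = refl
  δ-≢ {suc i} {suc j} i≢j = δ-≢ (i≢j ∘ ≡.cong suc)

  E≈δδ : ∀ i j a b → E i j a b ≈ δ (label a) i * δ (label b) j
  E≈δδ i j a b = ⟦∧⟧ (label a ℕ.≡ᵇ i) (label b ℕ.≡ᵇ j)

  -- A column of M is presented by a function g on all labels. If the column index of `E` lies
  -- outside the matrix, the operation does nothing, which the vanishing hypothesis on g reproduces.
  ·-rowOp : ∀ x i j {M} (g : ℕ → Carrier) b a → (∀ k → M k a ≈ g (label k)) →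
    (n ≤ j → g (suc j) ≈ 0#) →
    ((I ⊕ x • E i (suc j)) · M) b a ≈ g (label b) + δ (label b) i * (x * g (suc j))
  ·-rowOp x i j {M} g b a M≈g out = begin
    ((I ⊕ x • E i (suc j)) · M) b a
      ≈⟨ ·-distribʳ-⊕ M I (x • E i (suc j)) b a ⟩
    (I · M) b a + sum {n} (λ k → x * E i (suc j) b k * M k a)
      ≈⟨ +-cong (trans (·-identityˡ M b a) (M≈g b)) (sum-cong-≋ {n} term) ⟩
    g (label b) + sum {n} (λ k → δ (toℕ k) j * h (toℕ k))
      ≈⟨ +-congˡ (sum-δ {n} j h λ n≤j →
           trans (*-congˡ (trans (*-congˡ (out n≤j)) (zeroʳ x))) (zeroʳ _)) ⟩
    g (label b) + h j ∎
    where
    h : ℕ → Carrier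
    h k = δ (label b) i * (x * g (suc k))
    term : ∀ k → x * E i (suc j) b k * M k a ≈ δ (toℕ k) j * h (toℕ k)
    term k = begin
      x * E i (suc j) b k * M k a
        ≈⟨ *-cong (*-congˡ (E≈δδ i (suc j) b k)) (M≈g k) ⟩
      x * (δ (label b) i * δ (toℕ k) j) * g (label k)
        ≈⟨ *-congʳ (trans (*-congˡ (*-comm _ _)) (x∙yz≈y∙xz _ _ _)) ⟩
      δ (toℕ k) j * (x * δ (label b) i) * g (label k)
        ≈⟨ *-assoc _ _ _ ⟩
      δ (toℕ k) j * (x * δ (label b) i * g (label k))
        ≈⟨ *-congˡ (trans (*-congʳ (*-comm _ _)) (*-assoc _ _ _)) ⟩
      δ (toℕ k) j * h (toℕ k) ∎
      where open CommutativeSemigroupProperties *-commutativeSemigroup using (x∙yz≈y∙xz)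

  infix 8 _ᵀ
  _ᵀ : Matrix → Matrix
  (M ᵀ) i j = M j i

  ·-ᵀ : ∀ M N → (M · N) ᵀ ≋ N ᵀ · M ᵀ
  ·-ᵀ M N a b = sum-cong-≋ {n} (λ _ → *-comm _ _)

  Iᵀ : I ᵀ ≋ I
  Iᵀ a b = trans (I≈δ b a) (trans (δ-sym (label b) (label a)) (sym (I≈δ a b)))
    where
    δ-sym : ∀ i j → δ i j ≈ δ j i
    δ-sym zero    zero    = refl
    δ-sym zero    (suc _) = refl
    δ-sym (suc _) zero    = refl
    δ-sym (suc i) (suc j) = δ-sym i j

  Eᵀ : ∀ i j → E i j ᵀ ≋ E j i
  Eᵀ i j a b = trans (E≈δδ i j b a) (trans (*-comm _ _) (sym (E≈δδ j i a b)))

  ·-columnOp : ∀ x i j {M} (g : ℕ → Carrier) b a → (∀ k → M b k ≈ g (label k)) →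
    (n ≤ i → g (suc i) ≈ 0#) →
    (M · (I ⊕ x • E (suc i) j)) b a ≈ g (label a) + δ (label a) j * (x * g (suc i))
  ·-columnOp x i j {M} g b a M≈g out = begin
    (M · (I ⊕ x • E (suc i) j)) b a
      ≈⟨ ·-ᵀ M (I ⊕ x • E (suc i) j) a b ⟩
    ((I ⊕ x • E (suc i) j) ᵀ · M ᵀ) a b
      ≈⟨ ·-cong {N = M ᵀ} (λ p q → +-cong (Iᵀ p q) (*-congˡ (Eᵀ (suc i) j p q))) ≋-refl a b ⟩
    ((I ⊕ x • E j (suc i)) · M ᵀ) a b
      ≈⟨ ·-rowOp x j i {M ᵀ} g a b M≈g out ⟩
    g (label a) + δ (label a) j * (x * g (suc i)) ∎

  Eᵢᵢ· : ∀ i M b a → (E i i · M) b a ≈ δ (label b) i * M b a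
  Eᵢᵢ· i M b a = begin
    sum {n} (λ k → E i i b k * M k a)
      ≈⟨ sum-cong-≋ {n} (λ k → trans (*-congʳ (E≈δδ i i b k)) (*-assoc _ _ _)) ⟩
    sum {n} (λ k → δ (label b) i * (δ (label k) i * M k a))
      ≈⟨ *-distribˡ-sum {n} (δ (label b) i) _ ⟨
    δ (label b) i * sum {n} (λ k → δ (label k) i * M k a)
      ≈⟨ select (label b ℕₚ.≟ i) ⟩
    δ (label b) i * M b a ∎
    where
    select : Dec (label b ≡ i) → δ (label b) i * sum {n} (λ k → δ (label k) i * M k a)
                               ≈ δ (label b) i * M b a
    select (yes ≡.refl) = *-congˡ (trans
      (sum-cong-≋ {n} (λ k → *-congʳ (trans (sym (I≈δ k b)) (Iᵀ b k))))
      (·-identityˡ M b a))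
    select (no b≢i) = trans (*-congʳ (δ-≢ b≢i))
      (trans (zeroˡ _) (sym (trans (*-congʳ (δ-≢ b≢i)) (zeroˡ _))))

  module _ (y : ℕ → Carrier) where
    dilation : ℕ → Matrix
    dilation i = I ⊕ (y i + - 1#) • E i i

    dilation· : ∀ i M b a → (dilation i · M) b a ≈ M b a + (y i + - 1#) * (δ (label b) i * M b a)
    dilation· i M b a = trans (·-distribʳ-⊕ M I ((y i + - 1#) • E i i) b a)
      (+-cong (·-identityˡ M b a) (trans (•-·ˡ (y i + - 1#) (E i i) M b a) (*-congˡ (Eᵢᵢ· i M b a))))

    dilation-≢ : ∀ {i} M {b} a → label b ≢ i → (dilation i · M) b a ≈ M b a
    dilation-≢ {i} M {b} a b≢i = begin
      (dilation i · M) b a                              ≈⟨ dilation· i M b a ⟩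
      M b a + (y i + - 1#) * (δ (label b) i * M b a)    ≈⟨ +-congˡ (*-congˡ (trans (*-congʳ (δ-≢ b≢i)) (zeroˡ _))) ⟩
      M b a + (y i + - 1#) * 0#                         ≈⟨ +-congˡ (zeroʳ _) ⟩
      M b a + 0#                                        ≈⟨ +-identityʳ _ ⟩
      M b a                                             ∎

    dilation-≡ : ∀ M b a → (dilation (label b) · M) b a ≈ y (label b) * M b a
    dilation-≡ M b a = begin
      (dilation (label b) · M) b a
        ≈⟨ dilation· (label b) M b a ⟩
      M b a + (y (label b) + - 1#) * (δ (label b) (label b) * M b a)
        ≈⟨ +-cong (sym (*-identityˡ _)) (*-congˡ (trans (*-congʳ (δ-refl (label b))) (*-identityˡ _))) ⟩
      1# * M b a + (y (label b) + - 1#) * M b a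
        ≈⟨ distribʳ _ _ _ ⟨
      (1# + (y (label b) + - 1#)) * M b a
        ≈⟨ *-congʳ (trans (+-comm _ _) (trans (+-assoc _ _ _) (trans (+-congˡ (-‿inverseˡ _)) (+-identityʳ _)))) ⟩
      y (label b) * M b a ∎

    dilations-∉ : ∀ L M b a → label b ∉ L → (∏ (map dilation L) · M) b a ≈ M b a
    dilations-∉ []      M b a _   = ·-identityˡ M b a
    dilations-∉ (i ∷ L) M b a b∉L = begin
      (∏ (map dilation (i ∷ L)) · M) b a          ≈⟨ ·-assoc (dilation i) (∏ (map dilation L)) M b a ⟩
      (dilation i · (∏ (map dilation L) · M)) b a ≈⟨ dilation-≢ (∏ (map dilation L) · M) a (b∉L ∘ here) ⟩
      (∏ (map dilation L) · M) b a                ≈⟨ dilations-∉ L M b a (b∉L ∘ there) ⟩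
      M b a ∎

    -- Only the factor indexed by the label of b touches row b, and it occurs once in a list without
    -- repetitions.
    dilations-∈ : ∀ L M b a → Unique L → label b ∈ L →
      (∏ (map dilation L) · M) b a ≈ y (label b) * M b a
    dilations-∈ (i ∷ L) M b a uniq@(_ ∷ uniqL) b∈ = begin
      (∏ (map dilation (i ∷ L)) · M) b a          ≈⟨ ·-assoc (dilation i) (∏ (map dilation L)) M b a ⟩
      (dilation i · (∏ (map dilation L) · M)) b a ≈⟨ step b∈ ⟩
      y (label b) * M b a ∎
      where
      step : label b ∈ i ∷ L → (dilation i · (∏ (map dilation L) · M)) b a ≈ y (label b) * M b a
      step (here ≡.refl) = trans (dilation-≡ (∏ (map dilation L) · M) b a)
        (*-congˡ (dilations-∉ L M b a (Unique[x∷xs]⇒x∉xs uniq)))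
      step (there b∈L) = trans
        (dilation-≢ (∏ (map dilation L) · M) a λ { ≡.refl → Unique[x∷xs]⇒x∉xs uniq b∈L })
        (dilations-∈ L M b a uniqL b∈L)

  -- With the order of the factors reversed, the inverse of a product over L is a product over the
  -- same list L.
  ∏ʳ : List Matrix → Matrix
  ∏ʳ []       = I
  ∏ʳ (M ∷ Ms) = ∏ʳ Ms · M

  ∏ʳ-∷ʳ : ∀ Ms M → ∏ʳ (Ms ∷ʳ M) ≋ M · ∏ʳ Ms
  ∏ʳ-∷ʳ []       M = ≋-trans (·-identityˡ M) (≋-sym (·-identityʳ M))
  ∏ʳ-∷ʳ (N ∷ Ms) M = ≋-trans (·-cong (∏ʳ-∷ʳ Ms M) (≋-refl {N})) (·-assoc M (∏ʳ Ms) N)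

  ∏≋∏ʳ-reverse : ∀ Ms → ∏ Ms ≋ ∏ʳ (reverse Ms)
  ∏≋∏ʳ-reverse []       = ≋-refl
  ∏≋∏ʳ-reverse (M ∷ Ms) a b = begin
    (M · ∏ Ms) a b            ≈⟨ ·-cong (≋-refl {M}) (∏≋∏ʳ-reverse Ms) a b ⟩
    (M · ∏ʳ (reverse Ms)) a b ≈⟨ ∏ʳ-∷ʳ (reverse Ms) M a b ⟨
    ∏ʳ (reverse Ms ∷ʳ M) a b  ≡⟨ ≡.cong (λ Ns → ∏ʳ Ns a b) (unfold-reverse M Ms) ⟨
    ∏ʳ (reverse (M ∷ Ms)) a b ∎

  ∏-inverse : ∀ (G H : ℕ → Matrix) → (∀ i → G i · H i ≋ I) → ∀ L → ∏ (map G L) · ∏ʳ (map H L) ≋ I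
  ∏-inverse G H GH []      = ·-identityˡ I
  ∏-inverse G H GH (i ∷ L) a b = begin
    ((G i · ∏ (map G L)) · (∏ʳ (map H L) · H i)) a b
      ≈⟨ ·-assoc (G i) (∏ (map G L)) (∏ʳ (map H L) · H i) a b ⟩
    (G i · (∏ (map G L) · (∏ʳ (map H L) · H i))) a b
      ≈⟨ ·-cong (≋-refl {G i}) (≋-trans (≋-sym (·-assoc (∏ (map G L)) (∏ʳ (map H L)) (H i)))
           (≋-trans (·-cong (∏-inverse G H GH L) (≋-refl {H i})) (·-identityˡ (H i)))) a b ⟩
    (G i · H i) a b
      ≈⟨ GH i a b ⟩
    I a b ∎

  ∏ʳ-inverse : ∀ (G H : ℕ → Matrix) → (∀ i → H i · G i ≋ I) → ∀ L → ∏ʳ (map H L) · ∏ (map G L) ≋ I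
  ∏ʳ-inverse G H HG []      = ·-identityˡ I
  ∏ʳ-inverse G H HG (i ∷ L) a b = begin
    ((∏ʳ (map H L) · H i) · (G i · ∏ (map G L))) a b
      ≈⟨ ·-assoc (∏ʳ (map H L)) (H i) (G i · ∏ (map G L)) a b ⟩
    (∏ʳ (map H L) · (H i · (G i · ∏ (map G L)))) a b
      ≈⟨ ·-cong (≋-refl {∏ʳ (map H L)}) (≋-trans (≋-sym (·-assoc (H i) (G i) (∏ (map G L))))
           (≋-trans (·-cong (HG i) (≋-refl {∏ (map G L)})) (·-identityˡ (∏ (map G L))))) a b ⟩
    (∏ʳ (map H L) · ∏ (map G L)) a b
      ≈⟨ ∏ʳ-inverse G H HG L a b ⟩
    I a b ∎

  -- The square of E_{i,j} vanishes for i ≠ j, so the product is I + (x + y) E_{i,j}.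
  transvection-inverse : ∀ {i j x y} → i ≢ j → x + y ≈ 0# → (I ⊕ x • E i j) · (I ⊕ y • E i j) ≋ I
  transvection-inverse {i} {j} {x} {y} i≢j x+y≈0 a b = begin
    ((I ⊕ x • E i j) · N) a b
      ≈⟨ ·-distribʳ-⊕ N I (x • E i j) a b ⟩
    (I · N) a b + ((x • E i j) · N) a b
      ≈⟨ +-cong (·-identityˡ N a b) (·-distribˡ-⊕ (x • E i j) I (y • E i j) a b) ⟩
    (I a b + y * E i j a b) + (((x • E i j) · I) a b + ((x • E i j) · (y • E i j)) a b)
      ≈⟨ +-congˡ (+-cong (·-identityʳ (x • E i j) a b)
           (trans (•-·ʳ y (x • E i j) (E i j) a b) (trans (*-congˡ E²≈0) (zeroʳ y)))) ⟩
    (I a b + y * E i j a b) + (x * E i j a b + 0#)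
      ≈⟨ trans (+-assoc _ _ _) (+-congˡ (trans (+-congˡ (+-identityʳ _)) (sym (distribʳ _ _ _)))) ⟩
    I a b + (y + x) * E i j a b
      ≈⟨ +-congˡ (trans (*-congʳ (trans (+-comm y x) x+y≈0)) (zeroˡ _)) ⟩
    I a b + 0#
      ≈⟨ +-identityʳ _ ⟩
    I a b ∎
    where
    N = I ⊕ y • E i j
    term : ∀ k → E i j a k * E i j k b ≈ 0#
    term k with label k ℕₚ.≟ j
    ... | yes ≡.refl = trans (*-congˡ (trans (E≈δδ i j k b)
                         (trans (*-congʳ (δ-≢ (i≢j ∘ ≡.sym))) (zeroˡ _)))) (zeroʳ _)
    ... | no k≢j = trans (*-congʳ (trans (E≈δδ i j a k)
                     (trans (*-congˡ (δ-≢ k≢j)) (zeroʳ _)))) (zeroˡ _)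
    E²≈0 : ((x • E i j) · E i j) a b ≈ 0#
    E²≈0 = trans (•-·ˡ x (E i j) (E i j) a b)
      (trans (*-congˡ (trans (sum-cong-≋ {n} term) (sum-replicate-zero n))) (zeroʳ x))

  -- The sum of the products x b ⋯ x (a − 1) over all occurrences of
  -- b, b + 1, …, a − 1 as a subsequence of the list.
  chainSum : (ℕ → Carrier) → ℕ → ℕ → List ℕ → Carrier
  chainSum x b a []      = δ b a
  chainSum x b a (i ∷ L) = chainSum x b a L + δ b i * (x i * chainSum x (suc i) a L)

  chainProduct : (ℕ → Carrier) → ℕ → ℕ → Carrier
  chainProduct x b k = foldr _*_ 1# (map x (iterate suc b k))

  module _ (x : ℕ → Carrier) where
    private
      S : ℕ → ℕ → List ℕ → Carrier
      S = chainSum x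

    chainSum-≢ : ∀ {b} a {i} L → b ≢ i → S b a (i ∷ L) ≈ S b a L
    chainSum-≢ a L b≢i = trans (+-congˡ (trans (*-congʳ (δ-≢ b≢i)) (zeroˡ _))) (+-identityʳ _)

    chainSum-≡ : ∀ b a L → S b a (b ∷ L) ≈ S b a L + x b * S (suc b) a L
    chainSum-≡ b a L = +-congˡ (trans (*-congʳ (δ-refl b)) (*-identityˡ _))

    chainSum-> : ∀ {b a} L → a < b → S b a L ≈ 0#
    chainSum-> [] a<b = δ-≢ (ℕₚ.>⇒≢ a<b)
    chainSum-> {b} {a} (i ∷ L) a<b with b ℕₚ.≟ i
    ... | no b≢i = trans (chainSum-≢ a L b≢i) (chainSum-> L a<b)
    ... | yes ≡.refl = trans (chainSum-≡ b a L) (trans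
      (+-cong (chainSum-> L a<b) (trans (*-congˡ (chainSum-> L (ℕₚ.m<n⇒m<1+n a<b))) (zeroʳ _)))
      (+-identityʳ _))

    chainSum-diag : ∀ b L → S b b L ≈ 1#
    chainSum-diag b [] = δ-refl b
    chainSum-diag b (i ∷ L) with b ℕₚ.≟ i
    ... | no b≢i = trans (chainSum-≢ b L b≢i) (chainSum-diag b L)
    ... | yes ≡.refl = trans (chainSum-≡ b b L) (trans
      (+-cong (chainSum-diag b L) (trans (*-congˡ (chainSum-> L (ℕₚ.n<1+n b))) (zeroʳ _)))
      (+-identityʳ _))

    -- A chain from b to a uses every letter of b, ..., a - 1, in particular v.
    chainSum-∉ : ∀ {b v a} L → b ≤ v → v < a → v ∉ L → S b a L ≈ 0#
    chainSum-∉ [] b≤v v<a _ = δ-≢ (ℕₚ.<⇒≢ (ℕₚ.≤-<-trans b≤v v<a))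
    chainSum-∉ {b} {v} {a} (i ∷ L) b≤v v<a v∉ with b ℕₚ.≟ i
    ... | no b≢i = trans (chainSum-≢ a L b≢i) (chainSum-∉ L b≤v v<a (v∉ ∘ there))
    ... | yes ≡.refl = trans (chainSum-≡ b a L) (trans
      (+-cong (chainSum-∉ L b≤v v<a (v∉ ∘ there))
        (trans (*-congˡ (chainSum-∉ L (ℕₚ.≤∧≢⇒< b≤v (v∉ ∘ here ∘ ≡.sym)) v<a (v∉ ∘ there))) (zeroʳ _)))
      (+-identityʳ _))

    -- Without repetitions the chain occurs at most once as a subsequence, so the sum reduces to a
    -- single product.
    chainSum-⊆ : ∀ {L} b k → Unique L → iterate suc b k ⊆ L → S b (b ℕ.+ k) L ≈ chainProduct x b k
    chainSum-⊆ {L} b zero _ _ rewrite ℕₚ.+-identityʳ b = chainSum-diag b L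
    chainSum-⊆ {i ∷ L} b (suc k) uniq@(_ ∷ uniqL) (_ ∷ʳₛ s) = trans
      (chainSum-≢ (b ℕ.+ suc k) L λ { ≡.refl → Unique[x∷xs]⇒x∉xs uniq (⊆-lookup s (here ≡.refl)) })
      (chainSum-⊆ b (suc k) uniqL s)
    chainSum-⊆ {i ∷ L} b (suc k) uniq@(_ ∷ uniqL) (≡.refl ∷ₛ s) = begin
      S b (b ℕ.+ suc k) (b ∷ L)
        ≈⟨ chainSum-≡ b (b ℕ.+ suc k) L ⟩
      S b (b ℕ.+ suc k) L + x b * S (suc b) (b ℕ.+ suc k) L
        -- Chains that skip this b would need another b later in the list.
        ≈⟨ +-congʳ (chainSum-∉ L ℕₚ.≤-refl (ℕₚ.m<m+n b ℕ.z<s) (Unique[x∷xs]⇒x∉xs uniq)) ⟩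
      0# + x b * S (suc b) (b ℕ.+ suc k) L
        ≈⟨ +-identityˡ _ ⟩
      x b * S (suc b) (b ℕ.+ suc k) L
        ≡⟨ ≡.cong (λ a → x b * S (suc b) a L) (ℕₚ.+-suc b k) ⟩
      x b * S (suc b) (suc b ℕ.+ k) L
        ≈⟨ *-congˡ (chainSum-⊆ (suc b) k uniqL s) ⟩
      x b * chainProduct x (suc b) k ∎

    -- A chain across j and j + 1 needs j before j + 1, which is impossible when each occurs once
    -- and they stand in the opposite order.
    chainSum-broken : ∀ {L b a j} → Unique L → b ≤ j → suc j < a →
      (suc j ∷ j ∷ []) ⊆ L → S b a L ≈ 0#
    chainSum-broken {i ∷ L} {b} {a} {j} uniq@(_ ∷ uniqL) b≤j j+1<a s with b ℕₚ.≟ i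
    chainSum-broken {i ∷ L} {b} {a} {j} uniq@(_ ∷ uniqL) b≤j j+1<a (_ ∷ʳₛ s) | no b≢i =
      trans (chainSum-≢ a L b≢i) (chainSum-broken uniqL b≤j j+1<a s)
    chainSum-broken {i ∷ L} {b} {a} {j} uniq@(_ ∷ uniqL) b≤j j+1<a (≡.refl ∷ₛ s) | no b≢i =
      trans (chainSum-≢ a L b≢i)
        (chainSum-∉ L (ℕₚ.m≤n⇒m≤1+n b≤j) j+1<a (Unique[x∷xs]⇒x∉xs uniq))
    chainSum-broken {i ∷ L} {b} {a} {j} uniq b≤j j+1<a (≡.refl ∷ₛ s) | yes ≡.refl =
      contradiction b≤j ℕₚ.1+n≰n
    chainSum-broken {i ∷ L} {b} {a} {j} uniq@(_ ∷ uniqL) b≤j j+1<a (_ ∷ʳₛ s) | yes ≡.refl =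
      trans (chainSum-≡ b a L) (trans
        (+-cong (chainSum-∉ L ℕₚ.≤-refl (ℕₚ.≤-<-trans (ℕₚ.m≤n⇒m≤1+n b≤j) j+1<a) b∉L)
          (trans (*-congˡ (chainSum-broken uniqL (ℕₚ.≤∧≢⇒< b≤j b≢j) j+1<a s)) (zeroʳ _)))
        (+-identityʳ _))
      where
      b∉L = Unique[x∷xs]⇒x∉xs uniq
      b≢j : b ≢ j
      b≢j ≡.refl = b∉L (⊆-lookup s (there (here ≡.refl)))

    -- The recursion defining `chainSum` is the row operation performed by the leftmost factor. A
    -- letter i ≥ n acts trivially, since no chain from i + 1 can end at a label ≤ n.
    upperProduct : ∀ L b a → ∏ (map (λ i → I ⊕ x i • E i (suc i)) L) b a ≈ S (label b) (label a) L
    upperProduct []      b a = I≈δ b a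
    upperProduct (i ∷ L) b a = ·-rowOp (x i) i i {∏ (map (λ i → I ⊕ x i • E i (suc i)) L)} (λ k → S k (label a) L) b a
      (λ k → upperProduct L k a) (λ n≤i → chainSum-> L (s≤s (ℕₚ.<-≤-trans (Finₚ.toℕ<n a) n≤i)))

    -- The transposed form: in `∏ʳ` the head of the list is the rightmost factor and acts on
    -- columns. The factors are given up to `≋` because `f` is written without the scalar 1.
    lowerProduct : ∀ {G : ℕ → Matrix} → (∀ i → G i ≋ I ⊕ x i • E (suc i) i) →
      ∀ L b a → ∏ʳ (map G L) b a ≈ S (label a) (label b) L
    lowerProduct G≋ []      b a = trans (Iᵀ a b) (I≈δ a b)
    lowerProduct {G} G≋ (i ∷ L) b a = trans
      (·-cong (≋-refl {∏ʳ (map G L)}) (G≋ i) b a)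
      (·-columnOp (x i) i i {∏ʳ (map G L)} (λ k → S k (label b) L) b a
        (λ k → lowerProduct G≋ L b k)
        (λ n≤i → chainSum-> L (s≤s (ℕₚ.<-≤-trans (Finₚ.toℕ<n b) n≤i))))

-- Reversal of the blocks of a list

module BlockReversals where
  open import Data.Nat.Base using (_+_)
  open ≡

  take-length-++ : ∀ (xs ys : List X) → take (length xs) (xs ++ ys) ≡ xs
  take-length-++ []       ys = refl
  take-length-++ (x ∷ xs) ys = cong (x ∷_) (take-length-++ xs ys)

  drop-length-++ : ∀ (xs ys : List X) → drop (length xs) (xs ++ ys) ≡ ys
  drop-length-++ []       ys = refl
  drop-length-++ (x ∷ xs) ys = drop-length-++ xs ys

  drop-length+-++ : ∀ (xs ys zs : List X) → drop (length xs + length ys) (xs ++ ys ++ zs) ≡ zs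
  drop-length+-++ []       ys zs = drop-length-++ ys zs
  drop-length+-++ (x ∷ xs) ys zs = drop-length+-++ xs ys zs

  reverseBlock-++ : ∀ r xs ys zs {α β} →
    r ∸ β ≡ length xs → suc β ∸ α ≡ length ys → suc r ∸ α ≡ length xs + length ys →
    reverseBlock r (xs ++ ys ++ zs) (α , β) ≡ xs ++ reverse ys ++ zs
  reverseBlock-++ r xs ys zs p q u
    rewrite p | q | u | take-length-++ xs (ys ++ zs) | drop-length-++ xs (ys ++ zs)
          | take-length-++ ys zs | drop-length+-++ xs ys zs = refl

  -- The list c + d - 1, ..., c. It is indexed by its lowest entry because the blocks are processed
  -- upwards from there.
  descending : ℕ → ℕ → List ℕ
  descending c d = applyDownFrom (c +_) d

  descending-++ : ∀ c d e → descending c (e + d) ≡ descending (c + d) e ++ descending c d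
  descending-++ c d zero    = refl
  descending-++ c d (suc e) = cong₂ _∷_
    (trans (cong (λ x → c + x) (ℕₚ.+-comm e d)) (sym (ℕₚ.+-assoc c d e))) (descending-++ c d e)

  descending-⊆ : ∀ c {d e} → d ≤ e → descending c d ⊆ descending c e
  descending-⊆ c {d} d≤e with ℕₚ.m≤n⇒∃[o]m+o≡n d≤e
  ... | o , refl = subst (descending c d ⊆_)
    (sym (trans (cong (descending c) (ℕₚ.+-comm d o)) (descending-++ c d o)))
    (⊆-++⁺ˡ (descending (c + d) o) ⊆-refl)

  ∈-descending : ∀ {c d j} → c ≤ j → j < c + d → j ∈ descending c d
  ∈-descending {c} c≤j j<c+d with ℕₚ.m≤n⇒∃[o]m+o≡n c≤j
  ... | o , refl = ∈-applyDownFrom⁺ (c +_) (ℕₚ.+-cancelˡ-< c o _ j<c+d)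

  step-⊆-descending : ∀ {c d j} → c ≤ j → suc j < c + d → (suc j ∷ j ∷ []) ⊆ descending c d
  step-⊆-descending {c} {zero} {j} c≤j j+1<c rewrite ℕₚ.+-identityʳ c =
    contradiction (ℕₚ.<⇒≤ j+1<c) (ℕₚ.<⇒≱ (s≤s c≤j))
  step-⊆-descending {c} {suc d} {j} c≤j j+1<c+d with suc j ℕₚ.≟ c + d
  ... | yes e = e ∷ₛ from∈ (∈-descending c≤j (ℕₚ.≤-reflexive e))
  ... | no ¬e = c + d ∷ʳₛ step-⊆-descending c≤j
    (ℕₚ.≤∧≢⇒< (ℕₚ.≤-pred (subst (suc j <_) (ℕₚ.+-suc c d) j+1<c+d)) ¬e)

  applyUpTo≡iterate : ∀ {f : ℕ → ℕ} {b} k → (∀ j → f j ≡ b + j) → applyUpTo f k ≡ iterate suc b k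
  applyUpTo≡iterate zero f≡ = refl
  applyUpTo≡iterate {b = b} (suc k) f≡ = cong₂ _∷_ (trans (f≡ 0) (ℕₚ.+-identityʳ b))
    (applyUpTo≡iterate k (λ j → trans (f≡ (suc j)) (ℕₚ.+-suc b j)))

  iterate-⊆ : ∀ {a b} k n → a ≤ b → b + k ≤ a + n → iterate suc b k ⊆ iterate suc a n
  iterate-⊆ zero n _ _ = minimum _
  iterate-⊆ {a} {b} (suc k) zero a≤b le rewrite ℕₚ.+-identityʳ a =
    contradiction (ℕₚ.≤-trans le a≤b) (ℕₚ.m+1+n≰m b)
  iterate-⊆ {a} {b} (suc k) (suc n) a≤b le with a ℕₚ.≟ b
  ... | yes refl = refl ∷ₛ iterate-⊆ k n ℕₚ.≤-refl (subst₂ _≤_ (ℕₚ.+-suc a k) (ℕₚ.+-suc a n) le)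
  ... | no a≢b = a ∷ʳₛ iterate-⊆ (suc k) n (ℕₚ.≤∧≢⇒< a≤b a≢b) (subst (b + suc k ≤_) (ℕₚ.+-suc a n) le)

  -- The strict bound puts both j and j + 1 into the block, which decides their relative order after
  -- the reversal.
  Covers : ℕ → ℕ × ℕ → Set
  Covers j (α , β) = α ≤ j × j < β

  Uncovered : ℕ → List (ℕ × ℕ) → Set
  Uncovered j segs = ∀ {s} → s ∈ segs → ¬ Covers j s

  Between : ℕ → ℕ → ℕ × ℕ → Set
  Between c r (α , β) = c ≤ α × α < β × β ≤ r

  Before : Rel (ℕ × ℕ) _
  Before (_ , β) (α′ , _) = β < α′

  -- `block` and `broken` determine the order of consecutive letters, on which the entries of `F⁻¹`
  -- and `D · U` depend. `initial` serves the first column of `F`; its bound allows the starting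
  -- point α of every segment among the letters c, ..., c + k - 1.
  record BlockReversal (segs : List (ℕ × ℕ)) (c d : ℕ) (xs : List ℕ) : Set where
    field
      permutation : xs ↭ descending c d
      block       : ∀ {α β} → (α , β) ∈ segs → iterate suc α (suc β ∸ α) ⊆ xs
      broken      : ∀ {j} → c ≤ j → suc j < c + d → Uncovered j segs → (suc j ∷ j ∷ []) ⊆ xs
      initial     : ∀ k → k ≤ d → All (λ s → c + k ≤ suc (proj₁ s)) segs → descending c k ⊆ xs

  module _ {c g h e : ℕ} where
    private
      -- Coordinates free of subtraction: g letters below the block, h + 2 letters in it, e letters
      -- above it.
      α β : ℕ
      α = c + g
      β = suc (α + h)
      middle : List ℕ
      middle = descending α (suc (suc h))

    -- Reading from the right, the entries below α have already been processed,
    -- and the block β, …, α comes next.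
    reverseBlock-descending : ∀ ys →
      reverseBlock (β + e) (descending c (e + (suc (suc h) + g)) ++ ys) (α , β)
        ≡ descending (suc β) e ++ iterate suc α (suc (suc h)) ++ descending c g ++ ys
    reverseBlock-descending ys = begin
      reverseBlock (β + e) (descending c (e + (suc (suc h) + g)) ++ ys) (α , β)
        ≡⟨ cong (λ xs → reverseBlock (β + e) xs (α , β)) split ⟩
      reverseBlock (β + e) (descending (suc β) e ++ middle ++ descending c g ++ ys) (α , β)
        ≡⟨ reverseBlock-++ (β + e) (descending (suc β) e) middle (descending c g ++ ys) {α} {β}
             (trans (ℕₚ.m+n∸m≡n β e) (sym lengthˡ))
             (trans (cong (_∸ α) (widen α h)) (trans (ℕₚ.m+n∸m≡n α (suc (suc h))) (sym lengthᵐ)))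
             (trans (cong (_∸ α) (total α h e))
               (trans (ℕₚ.m+n∸m≡n α (e + suc (suc h))) (sym (cong₂ _+_ lengthˡ lengthᵐ)))) ⟩
      descending (suc β) e ++ reverse middle ++ descending c g ++ ys
        ≡⟨ cong (λ xs → descending (suc β) e ++ xs ++ descending c g ++ ys)
             (trans (reverse-applyDownFrom (α +_) (suc (suc h)))
               (applyUpTo≡iterate (suc (suc h)) (λ _ → refl))) ⟩
      descending (suc β) e ++ iterate suc α (suc (suc h)) ++ descending c g ++ ys ∎
      where
      open ≡-Reasoning
      widen : ∀ α h → suc (suc (α + h)) ≡ α + suc (suc h)
      widen = solve-∀
      total : ∀ α h e → suc (suc (α + h) + e) ≡ α + (e + suc (suc h))
      total = solve-∀
      top : ∀ c g h → c + (suc (suc h) + g) ≡ suc (suc (c + g + h))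
      top = solve-∀
      lengthˡ = length-applyDownFrom (suc β +_) e
      lengthᵐ = length-applyDownFrom (α +_) (suc (suc h))
      split : descending c (e + (suc (suc h) + g)) ++ ys
            ≡ descending (suc β) e ++ middle ++ descending c g ++ ys
      split rewrite descending-++ c (suc (suc h) + g) e | descending-++ c g (suc (suc h)) | top c g h
        = trans (++-assoc (descending (suc β) e) (middle ++ descending c g) ys)
                (cong (descending (suc β) e ++_) (++-assoc middle (descending c g) ys))

    blockReversal-∷ : ∀ {segs xs} → BlockReversal segs (suc β) e xs → All (Before (α , β)) segs →
      BlockReversal ((α , β) ∷ segs) c (e + (suc (suc h) + g))
        (xs ++ iterate suc α (suc (suc h)) ++ descending c g)
    blockReversal-∷ {segs} {xs} rest sorted = record
      { permutation = ↭-trans (↭ₚ.++⁺ (R.permutation) (↭ₚ.++⁺ up↭middle ↭-refl)) (↭-reflexive (sym split))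
      ; block = λ { (here refl) → subst (λ k → iterate suc α k ⊆ result) (sym size)
                      (⊆-++⁺ˡ xs (⊆-++⁺ʳ (descending c g) ⊆-refl))
                  ; (there s∈) → ⊆-++⁺ʳ _ (R.block s∈) }
      ; broken = broken′
      ; initial = λ { k _ (c+k≤ ∷ _) → ⊆-trans (descending-⊆ c (k≤1+g c+k≤)) low }
      }
      where
      module R = BlockReversal rest
      result = xs ++ iterate suc α (suc (suc h)) ++ descending c g
      up↭middle : iterate suc α (suc (suc h)) ↭ middle
      up↭middle = ↭-trans (↭-reflexive (sym (trans (reverse-applyDownFrom (α +_) (suc (suc h)))
        (applyUpTo≡iterate (suc (suc h)) (λ _ → refl))))) (↭ₚ.↭-reverse middle)
      top : ∀ c g h → c + (suc (suc h) + g) ≡ suc (suc (c + g + h))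
      top = solve-∀
      split : descending c (e + (suc (suc h) + g)) ≡ descending (suc β) e ++ middle ++ descending c g
      split rewrite descending-++ c (suc (suc h) + g) e | descending-++ c g (suc (suc h)) | top c g h = refl
      size : suc β ∸ α ≡ suc (suc h)
      size = trans (cong (_∸ α) (trans (cong suc (sym (ℕₚ.+-suc α h))) (sym (ℕₚ.+-suc α (suc h)))))
                   (ℕₚ.m+n∸m≡n α (suc (suc h)))
      -- The ascending run begins with α, which therefore still precedes all smaller letters.
      low : descending c (suc g) ⊆ result
      low = ⊆-++⁺ˡ xs (refl ∷ₛ ⊆-++⁺ˡ (iterate suc (suc α) (suc h)) ⊆-refl)
      k≤1+g : ∀ {k} → c + k ≤ suc (c + g) → k ≤ suc g
      k≤1+g {k} le = ℕₚ.+-cancelˡ-≤ c k (suc g) (subst (c + k ≤_) (sym (ℕₚ.+-suc c g)) le)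
      end : ∀ c g h e → c + (e + (suc (suc h) + g)) ≡ suc (suc (c + g + h)) + e
      end = solve-∀
      broken′ : ∀ {j} → c ≤ j → suc j < c + (e + (suc (suc h) + g)) →
        Uncovered j ((α , β) ∷ segs) → (suc j ∷ j ∷ []) ⊆ result
      broken′ {j} c≤j j<top unc with ℕₚ.<-cmp j β
      ... | tri> _ _ β<j = ⊆-++⁺ʳ _ (R.broken β<j (subst (suc j <_) (end c g h e) j<top) (unc ∘ there))
      -- At the upper border of the block, β + 1 comes from the part on the left and β from the run.
      ... | tri≈ _ refl _ = ⊆-++⁺
        (from∈ (↭ₚ.∈-resp-↭ (↭-sym R.permutation)
          (∈-descending ℕₚ.≤-refl (subst (suc β <_) (end c g h e) j<top))))
        (⊆-++⁺ʳ (descending c g) (from∈ (subst (β ∈_) (applyUpTo≡iterate (suc (suc h)) (λ _ → refl))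
          (subst (_∈ applyUpTo (α +_) (suc (suc h))) (ℕₚ.+-suc α h)
            (∈-applyUpTo⁺ (α +_) (ℕₚ.n<1+n (suc h)))))))
      ... | tri< j<β _ _ with α ℕₚ.≤? j
      ...   | yes α≤j = contradiction (α≤j , j<β) (unc (here refl))
      ...   | no  α≰j = ⊆-trans (step-⊆-descending c≤j
          (subst (suc j <_) (sym (ℕₚ.+-suc c g)) (s≤s (ℕₚ.≰⇒> α≰j)))) low

  private
    block-total : ∀ c g h e → suc (suc (c + g + h) + e) ≡ c + (e + (suc (suc h) + g))
    block-total = solve-∀

  -- The fold meets the leftmost segment first, which sits at the right end of the list. The
  -- induction therefore raises c past each block and moves the finished part into the suffix `ys`.
  reversal : ∀ r c d ys segs → c + d ≡ suc r → All (Between c r) segs → AllPairs Before segs →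
    ∃[ xs ] foldl (reverseBlock r) (descending c d ++ ys) segs ≡ xs ++ ys × BlockReversal segs c d xs
  reversal r c d ys [] _ _ _ = descending c d , refl , record
    { permutation = ↭-refl
    ; block = λ ()
    ; broken = λ c≤j j<c+d _ → step-⊆-descending c≤j j<c+d
    ; initial = λ k k≤d _ → descending-⊆ c k≤d }
  reversal r c d ys ((α , β) ∷ segs) c+d≡1+r ((c≤α , α<β , β≤r) ∷ between) (sorted ∷ pairs)
    with ℕₚ.m≤n⇒∃[o]m+o≡n c≤α | ℕₚ.m≤n⇒∃[o]m+o≡n α<β | ℕₚ.m≤n⇒∃[o]m+o≡n β≤r
  ... | g , refl | h , refl | e , refl
    with refl ← ℕₚ.+-cancelˡ-≡ c d (e + (suc (suc h) + g)) (trans c+d≡1+r (block-total c g h e))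
    with xs , eq , rest ← reversal r (suc β) e (iterate suc α (suc (suc h)) ++ descending c g ++ ys) segs refl
          (All.zipWith (λ { (β<α′ , _ , α′<β′ , β′≤r) → β<α′ , α′<β′ , β′≤r }) (sorted , between)) pairs
    = xs ++ iterate suc α (suc (suc h)) ++ descending c g
    , (begin
        foldl (reverseBlock r) (reverseBlock r (descending c (e + (suc (suc h) + g)) ++ ys) (α , β)) segs
          ≡⟨ cong (λ zs → foldl (reverseBlock r) zs segs) (reverseBlock-descending {c} {g} {h} {e} ys) ⟩
        foldl (reverseBlock r) (descending (suc β) e ++ iterate suc α (suc (suc h)) ++ descending c g ++ ys) segs
          ≡⟨ eq ⟩
        xs ++ iterate suc α (suc (suc h)) ++ descending c g ++ ys
          ≡⟨ cong (xs ++_) (++-assoc (iterate suc α (suc (suc h))) (descending c g) ys) ⟨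
        xs ++ (iterate suc α (suc (suc h)) ++ descending c g) ++ ys
          ≡⟨ ++-assoc xs _ ys ⟨
        (xs ++ iterate suc α (suc (suc h)) ++ descending c g) ++ ys ∎)
    , blockReversal-∷ rest sorted
    where open ≡-Reasoning

  -- If every consecutive pair in b, ..., b + k + 1 is covered, one segment covers them all, because
  -- segments covering neighbouring pairs share a letter and distinct segments are disjoint.
  covered⊎uncovered : ∀ {segs} b k → AllPairs Before segs →
    (∃[ α ] ∃[ β ] (α , β) ∈ segs × α ≤ b × b + suc k ≤ β) ⊎
    (∃[ j ] b ≤ j × j < b + suc k × Uncovered j segs)
  covered⊎uncovered {segs} b k sorted with k
  ... | zero with any? (λ (α , β) → α ℕₚ.≤? b ×-dec b ℕₚ.<? β) segs
  ...   | yes c with find c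
  ...     | (α , β) , s∈ , α≤b , b<β = inj₁ (α , β , s∈ , α≤b , subst (_≤ β) (sym (ℕₚ.+-comm b 1)) b<β)
  covered⊎uncovered {segs} b k sorted | zero | no ¬c =
    inj₂ (b , ℕₚ.≤-refl , ℕₚ.m<m+n b (s≤s z≤n) , λ s∈ cov → ¬c (lose s∈ cov))
  covered⊎uncovered {segs} b k sorted | suc k′ with covered⊎uncovered b k′ sorted
  ... | inj₂ (j , b≤j , j< , unc) = inj₂ (j , b≤j , ℕₚ.<-trans j< (ℕₚ.+-monoʳ-< b (ℕₚ.n<1+n _)) , unc)
  ... | inj₁ (α , β , s∈ , α≤b , le) with any? (λ (α , β) → α ℕₚ.≤? b + suc k′ ×-dec b + suc k′ ℕₚ.<? β) segs
  ...   | no ¬c = inj₂ (b + suc k′ , ℕₚ.m≤m+n b _ , ℕₚ.+-monoʳ-< b (ℕₚ.n<1+n _) , λ s∈ cov → ¬c (lose s∈ cov))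
  ...   | yes c with find c
  ...     | (α′ , β′) , s∈′ , α′≤ , <β′ = inj₁ (α , β , s∈ , α≤b , extend (compare sorted s∈ s∈′))
    where
    compare : ∀ {segs} {s s′ : ℕ × ℕ} → AllPairs Before segs → s ∈ segs → s′ ∈ segs →
      s ≡ s′ ⊎ Before s s′ ⊎ Before s′ s
    compare (ps ∷ _) (here refl) (here refl) = inj₁ refl
    compare (ps ∷ _) (here refl) (there s∈) = inj₂ (inj₁ (All.lookup ps s∈))
    compare (ps ∷ _) (there s∈) (here refl) = inj₂ (inj₂ (All.lookup ps s∈))
    compare (_ ∷ pss) (there s∈) (there s′∈) = compare pss s∈ s′∈
    -- The letter b + k′ + 1 lies in both segments, which rules out that either lies before the
    -- other.
    extend : (α , β) ≡ (α′ , β′) ⊎ β < α′ ⊎ β′ < α → b + suc (suc k′) ≤ β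
    extend (inj₁ refl) = subst (_≤ β) (sym (ℕₚ.+-suc b (suc k′))) <β′
    extend (inj₂ (inj₁ β<α′)) = contradiction (ℕₚ.≤-trans α′≤ le) (ℕₚ.<⇒≱ β<α′)
    extend (inj₂ (inj₂ β′<α)) = contradiction
      (ℕₚ.≤-trans α≤b (ℕₚ.≤-trans (ℕₚ.m≤m+n b (suc k′)) (ℕₚ.<⇒≤ <β′))) (ℕₚ.<⇒≱ β′<α)

  -- Disjointness of maximal segments

  AllPairs-restrict : ∀ {P : X → Set p} {R : Rel X ℓ} {Q : Rel X ℓ′} {xs} →
    (∀ {x y} → P x → P y → R x y → Q x y) → All P xs → AllPairs R xs → AllPairs Q xs
  AllPairs-restrict f []         []         = []
  AllPairs-restrict f (px ∷ pxs) (rs ∷ rss) =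
    All.zipWith (λ (py , r) → f px py r) (pxs , rs) ∷ AllPairs-restrict f pxs rss

  Lexicographic : Rel (ℕ × ℕ) _
  Lexicographic (α , β) (α′ , β′) = α < α′ ⊎ (α ≡ α′ × β < β′)

  cartesianProduct-lexicographic : ∀ {xs ys} → AllPairs _<_ xs → AllPairs _<_ ys →
    AllPairs Lexicographic (cartesianProduct xs ys)
  cartesianProduct-lexicographic [] _ = []
  cartesianProduct-lexicographic {x ∷ xs} {ys} (x< ∷ xs<) ys< = AllPairsₚ.++⁺
    (AllPairsₚ.map⁺ (AllPairs.map (λ β<β′ → inj₂ (refl , β<β′)) ys<))
    (cartesianProduct-lexicographic xs< ys<)
    (Allₚ.map⁺ (All.tabulate (λ _ → All.map inj₁ (All-proj₁ x<))))
    where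
    All-proj₁ : ∀ {xs} → All (x <_) xs → All (λ s → x < proj₁ s) (cartesianProduct xs ys)
    All-proj₁ []       = []
    All-proj₁ (p ∷ ps) = Allₚ.++⁺ (Allₚ.map⁺ (All.tabulate (λ _ → p))) (All-proj₁ ps)

  interval-ascending : ∀ lo hi → AllPairs _<_ [ lo ⋯ hi ]
  interval-ascending lo hi = AllPairsₚ.applyUpTo⁺₁ (lo +_) (suc hi ∸ lo) (λ i<j _ → ℕₚ.+-monoʳ-< lo i<j)

  module _ {r : ℕ} (s : ℤ) (m : Vector ℤ r) where

    -- Both segments have slope s and share the index α′, so the second continues the linear formula
    -- of the first.
    segment-∪ : ∀ {α β α′ β′} → α ≤ α′ → α′ ≤ β → β ≤ β′ →
      IsSegment s m α β → IsSegment s m α′ β′ → IsSegment s m α β′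
    segment-∪ {α} {β} {α′} {β′} α≤α′ α′≤β β≤β′ (segment 1≤α α<β _ lin) (segment _ _ β′≤r lin′) =
      segment 1≤α (ℕₚ.<-≤-trans α<β β≤β′) β′≤r lin″
      where
      regroup : ∀ x s i j → x ℤ.+ s ℤ.* i ℤ.+ s ℤ.* j ≡ x ℤ.+ s ℤ.* (i ℤ.+ j)
      regroup = ℤSolver.solve-∀
      lin″ : ∀ j → j ≤ β′ ∸ α → at m (α + j) ≡ at m α ℤ.+ s ℤ.* (pos j)
      lin″ j j≤ with j ℕₚ.≤? β ∸ α
      ... | yes j≤β-α = lin j j≤β-α
      -- Beyond β the index is α + i + k with α′ = α + i: the second segment accounts for k, the
      -- first for i.
      ... | no  j≰β-α with ℕₚ.m≤n⇒∃[o]m+o≡n α≤α′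
      ...   | i , refl with ℕₚ.m≤n⇒∃[o]m+o≡n {i} {j} (ℕₚ.≤-trans
                (subst (_≤ β ∸ α) (ℕₚ.m+n∸m≡n α i) (ℕₚ.∸-monoˡ-≤ α α′≤β)) (ℕₚ.<⇒≤ (ℕₚ.≰⇒> j≰β-α)))
      ...     | k , refl = begin
        at m (α + (i + k))                                  ≡⟨ cong (at m) (ℕₚ.+-assoc α i k) ⟨
        at m (α + i + k)                                    ≡⟨ lin′ k k≤ ⟩
        at m (α + i) ℤ.+ s ℤ.* (pos k)                        ≡⟨ cong (ℤ._+ s ℤ.* (pos k)) (lin i i≤) ⟩
        at m α ℤ.+ s ℤ.* (pos i) ℤ.+ s ℤ.* (pos k)              ≡⟨ regroup (at m α) s (pos i) (pos k) ⟩
        at m α ℤ.+ s ℤ.* (pos (i + k)) ∎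
        where
        open ≡-Reasoning
        i≤ : i ≤ β ∸ α
        i≤ = subst (_≤ β ∸ α) (ℕₚ.m+n∸m≡n α i) (ℕₚ.∸-monoˡ-≤ α α′≤β)
        k≤ : k ≤ β′ ∸ (α + i)
        k≤ = subst (k ≤_) (ℕₚ.∸-+-assoc β′ α i)
               (subst (_≤ β′ ∸ α ∸ i) (ℕₚ.m+n∸m≡n i k) (ℕₚ.∸-monoˡ-≤ i j≤))

    -- If they met, either one would contain the other or their union would be a longer segment;
    -- both contradict maximality.
    maximalSegments-before : ∀ {α β α′ β′} → IsMaximalSegment s m α β → IsMaximalSegment s m α′ β′ →
      Lexicographic (α , β) (α′ , β′) → β < α′
    maximalSegments-before (maximalSegment seg max) (maximalSegment seg′ max′) (inj₂ (refl , β<β′)) =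
      contradiction (sym (proj₂ (max _ _ seg′ ℕₚ.≤-refl (ℕₚ.<⇒≤ β<β′)))) (ℕₚ.<⇒≢ β<β′)
    maximalSegments-before {α} {β} {α′} {β′} (maximalSegment seg max) (maximalSegment seg′ max′) (inj₁ α<α′)
      with β ℕₚ.<? α′
    ... | yes β<α′ = β<α′
    ... | no  β≮α′ with β′ ℕₚ.≤? β
    ...   | yes β′≤β = contradiction (proj₁ (max′ _ _ seg (ℕₚ.<⇒≤ α<α′) β′≤β)) (ℕₚ.<⇒≢ α<α′)
    ...   | no  β′≰β = contradiction
      (sym (proj₂ (max _ _ (segment-∪ (ℕₚ.<⇒≤ α<α′) (ℕₚ.≮⇒≥ β≮α′) (ℕₚ.<⇒≤ (ℕₚ.≰⇒> β′≰β)) seg seg′)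
        ℕₚ.≤-refl (ℕₚ.<⇒≤ (ℕₚ.≰⇒> β′≰β)))))
      (ℕₚ.<⇒≢ (ℕₚ.≰⇒> β′≰β))

    private
      segs : List (ℕ × ℕ)
      segs = maximalSegments s m

      allMaximal : All (λ (α , β) → IsMaximalSegment s m α β) segs
      allMaximal = Allₚ.all-filter (λ (α , β) → isMaximalSegment? s m α β) (cartesianProduct [ 1 ⋯ r ] [ 1 ⋯ r ])

    maximalSegments-sorted : AllPairs Before segs
    maximalSegments-sorted = AllPairs-restrict maximalSegments-before allMaximal
      (AllPairsₚ.filter⁺ (λ (α , β) → isMaximalSegment? s m α β)
        (cartesianProduct-lexicographic (interval-ascending 1 r) (interval-ascending 1 r)))

    maximalSegments-between : All (Between 1 r) segs
    maximalSegments-between = All.map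
      (λ { (maximalSegment (segment 1≤α α<β β≤r _) _) → 1≤α , α<β , β≤r }) allMaximal

    maximalSegments-reversal :
      BlockReversal segs 1 r (foldl (reverseBlock r) (applyDownFrom suc r) segs)
    maximalSegments-reversal
      with xs , eq , rev ← reversal r 1 r [] segs refl maximalSegments-between maximalSegments-sorted
      = subst (BlockReversal segs 1 r)
          (sym (trans (cong (λ xs → foldl (reverseBlock r) xs segs) (sym (++-identityʳ (applyDownFrom suc r))))
                 (trans eq (++-identityʳ xs)))) rev

open BlockReversals

-- Nonvanishing of the Q-system

module FieldProperties (K : Field c ℓ) where
  open Field K hiding (zero)
  open SetoidReasoning setoid

  *-≉0 : ∀ {x y} → ¬ x ≈ 0# → ¬ y ≈ 0# → ¬ x * y ≈ 0#
  *-≉0 {x} {y} x≉0 y≉0 xy≈0 = y≉0 (begin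
    y                ≈⟨ *-identityˡ y ⟨
    1# * y           ≈⟨ *-congʳ (*-inverse x≉0) ⟨
    x * x ⁻¹ * y     ≈⟨ *-congʳ (*-comm _ _) ⟩
    x ⁻¹ * x * y     ≈⟨ *-assoc _ _ _ ⟩
    x ⁻¹ * (x * y)   ≈⟨ *-congˡ xy≈0 ⟩
    x ⁻¹ * 0#        ≈⟨ zeroʳ _ ⟩
    0# ∎)

  ⁻¹-≉0 : ∀ {x} → ¬ x ≈ 0# → ¬ x ⁻¹ ≈ 0#
  ⁻¹-≉0 {x} x≉0 x⁻¹≈0 = 1≉0 (trans (sym (*-inverse x≉0)) (trans (*-congˡ x⁻¹≈0) (zeroʳ x)))

  /-≉0 : ∀ {x y} → ¬ x ≈ 0# → ¬ y ≈ 0# → ¬ x / y ≈ 0#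
  /-≉0 x≉0 y≉0 = *-≉0 x≉0 (⁻¹-≉0 y≉0)

  *-/-cancel : ∀ x {y} → ¬ y ≈ 0# → y * (x / y) ≈ x
  *-/-cancel x {y} y≉0 = begin
    y * (x * y ⁻¹)   ≈⟨ *-congˡ (*-comm _ _) ⟩
    y * (y ⁻¹ * x)   ≈⟨ *-assoc _ _ _ ⟨
    y * y ⁻¹ * x     ≈⟨ *-congʳ (*-inverse y≉0) ⟩
    1# * x           ≈⟨ *-identityˡ x ⟩
    x ∎

  /-unique : ∀ {x y z} → ¬ y ≈ 0# → z * y ≈ x → z ≈ x / y
  /-unique {x} {y} {z} y≉0 zy≈x = begin
    z                ≈⟨ *-identityʳ z ⟨
    z * 1#           ≈⟨ *-congˡ (*-inverse y≉0) ⟨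
    z * (y * y ⁻¹)   ≈⟨ *-assoc _ _ _ ⟨
    z * y * y ⁻¹     ≈⟨ *-congʳ zy≈x ⟩
    x * y ⁻¹ ∎

-- Subtraction-free elements

module PositiveElements (K : Field c ℓ) {n : ℕ} (x : Vector (Field.Carrier K) n) where
  open Field K hiding (zero)
  open RawSemiringDefs (RawRing.rawSemiring rawRing) using (sum; product; _^_) renaming (_×_ to _×ℕ_)
  open SetoidReasoning setoid
  open CommutativeSemigroupProperties (CommutativeRing.+-commutativeSemigroup commutativeRing)
    using () renaming (x∙yz≈y∙xz to x+[y+z]≈y+[x+z])
  open CommutativeSemigroupProperties (CommutativeRing.*-commutativeSemigroup commutativeRing)
    using (interchange; xy∙z≈xz∙y)

  Exponent : Set
  Exponent = Vec ℕ n

  -- Repetitions stand for multiplicities, so sums and products become operations on lists and no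
  -- coefficients appear yet.
  value : List Exponent → Carrier
  value = foldr (λ e y → monomial K x e + y) 0#

  value-++ : ∀ es fs → value (es ++ fs) ≈ value es + value fs
  value-++ []       fs = sym (+-identityˡ _)
  value-++ (e ∷ es) fs = trans (+-congˡ (value-++ es fs)) (sym (+-assoc _ _ _))

  private
    module Product = CommutativeMonoidSum (CommutativeRing.*-commutativeMonoid commutativeRing)

  infixl 6 _+ᵉ_
  _+ᵉ_ : Exponent → Exponent → Exponent
  _+ᵉ_ = Vec.zipWith ℕ._+_

  monomial-+ : ∀ e f → monomial K x (e +ᵉ f) ≈ monomial K x e * monomial K x f
  monomial-+ e f = trans
    (Product.sum-cong-≋ {n} (λ i → trans
      (reflexive (≡.cong (x i ^_) (Vecₚ.lookup-zipWith ℕ._+_ i e f)))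
      (SemiringExp.^-homo-* semiring (x i) (Vec.lookup e i) (Vec.lookup f i))))
    (Product.∑-distrib-+ {n} _ _)

  value-map : ∀ e fs → value (map (e +ᵉ_) fs) ≈ monomial K x e * value fs
  value-map e []       = sym (zeroʳ _)
  value-map e (f ∷ fs) = trans (+-cong (monomial-+ e f) (value-map e fs)) (sym (distribˡ _ _ _))

  value-* : ∀ es fs → value (cartesianProductWith _+ᵉ_ es fs) ≈ value es * value fs
  value-* []       fs = sym (zeroˡ _)
  value-* (e ∷ es) fs = begin
    value (map (e +ᵉ_) fs ++ cartesianProductWith _+ᵉ_ es fs)
      ≈⟨ value-++ (map (e +ᵉ_) fs) _ ⟩
    value (map (e +ᵉ_) fs) + value (cartesianProductWith _+ᵉ_ es fs)
      ≈⟨ +-cong (value-map e fs) (value-* es fs) ⟩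
    monomial K x e * value fs + value es * value fs
      ≈⟨ distribʳ _ _ _ ⟨
    (monomial K x e + value es) * value fs ∎

  -- A term (e , k) stands for the monomial e with coefficient k + 1.
  Terms : Set
  Terms = List (Exponent × ℕ)

  termsValue : Terms → Carrier
  termsValue = foldr (λ (e , k) y → suc k ×ℕ monomial K x e + y) 0#

  -- Algebraic independence speaks of distinct exponents, so like terms have to be merged. Merging
  -- only increases a coefficient, hence nothing cancels.
  insert : Exponent → Terms → Terms
  insert e []             = (e , 0) ∷ []
  insert e ((f , k) ∷ ts) with Vecₚ.≡-dec ℕₚ._≟_ e f
  ... | yes _ = (f , suc k) ∷ ts
  ... | no  _ = (f , k) ∷ insert e ts

  insert-value : ∀ e ts → termsValue (insert e ts) ≈ monomial K x e + termsValue ts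
  insert-value e []             = +-congʳ (+-identityʳ _)
  insert-value e ((f , k) ∷ ts) with Vecₚ.≡-dec ℕₚ._≟_ e f
  ... | yes ≡.refl = +-assoc _ _ _
  ... | no  _      = trans (+-congˡ (insert-value e ts)) (x+[y+z]≈y+[x+z] _ _ _)

  insert-≢ : ∀ {e f} ts → f ≢ e → All (f ≢_) (map proj₁ ts) → All (f ≢_) (map proj₁ (insert e ts))
  insert-≢ []             f≢e _ = f≢e ∷ []
  insert-≢ {e} ((g , k) ∷ ts) f≢e (f≢g ∷ f∉) with Vecₚ.≡-dec ℕₚ._≟_ e g
  ... | yes _ = f≢g ∷ f∉
  ... | no  _ = f≢g ∷ insert-≢ ts f≢e f∉

  insert-unique : ∀ e ts → Unique (map proj₁ ts) → Unique (map proj₁ (insert e ts))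
  insert-unique e []             _ = [] ∷ []
  insert-unique e ((f , k) ∷ ts) (f∉ ∷ uniq) with Vecₚ.≡-dec ℕₚ._≟_ e f
  ... | yes _  = f∉ ∷ uniq
  ... | no e≢f = insert-≢ ts (e≢f ∘ ≡.sym) f∉ ∷ insert-unique e ts uniq

  insert-≢[] : ∀ e ts → insert e ts ≢ []
  insert-≢[] e ((f , k) ∷ ts) eq with Vecₚ.≡-dec ℕₚ._≟_ e f
  insert-≢[] e ((f , k) ∷ ts) () | yes _
  insert-≢[] e ((f , k) ∷ ts) () | no _

  collect : List Exponent → Terms
  collect = foldr insert []

  collect-value : ∀ es → termsValue (collect es) ≈ value es
  collect-value []       = refl
  collect-value (e ∷ es) = trans (insert-value e (collect es)) (+-congˡ (collect-value es))

  collect-unique : ∀ es → Unique (map proj₁ (collect es))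
  collect-unique []       = []
  collect-unique (e ∷ es) = insert-unique e (collect es) (collect-unique es)

  exponents-injective : ∀ (ts : Terms) → Unique (map proj₁ ts) → Injective _≡_ _≡_ (proj₁ ∘ lookup ts)
  exponents-injective (_ ∷ ts) _           {zero}  {zero}  _  = ≡.refl
  exponents-injective (_ ∷ ts) (e∉ ∷ _)    {zero}  {suc j} eq =
    contradiction eq (All.lookup e∉ (∈-map⁺ proj₁ (∈-lookup {xs = ts} j)))
  exponents-injective (_ ∷ ts) (e∉ ∷ _)    {suc i} {zero}  eq =
    contradiction (≡.sym eq) (All.lookup e∉ (∈-map⁺ proj₁ (∈-lookup {xs = ts} i)))
  exponents-injective (_ ∷ ts) (_ ∷ uniq)  {suc i} {suc j} eq =
    ≡.cong suc (exponents-injective ts uniq eq)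

  sum-terms : ∀ ts →
    sum (λ i → intMul K (pos (suc (proj₂ (lookup ts i)))) (monomial K x (proj₁ (lookup ts i)))) ≈ termsValue ts
  sum-terms []       = refl
  sum-terms (_ ∷ ts) = +-congˡ (sum-terms ts)

  IsPositive : Carrier → Set ℓ
  IsPositive y = ∃[ e ] ∃[ es ] y ≈ value (e ∷ es)

  1-positive : IsPositive 1#
  1-positive = Vec.replicate n 0 , [] , sym (trans (+-identityʳ _)
    (trans (Product.sum-cong-≋ {n} (λ i → reflexive (≡.cong (x i ^_) (Vecₚ.lookup-replicate i 0))))
           (Product.sum-replicate-zero n)))

  +-positive : ∀ {y z} → IsPositive y → IsPositive z → IsPositive (y + z)
  +-positive (e , es , y≈) (f , fs , z≈) =
    e , es ++ f ∷ fs , trans (+-cong y≈ z≈) (sym (value-++ (e ∷ es) (f ∷ fs)))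

  *-positive : ∀ {y z} → IsPositive y → IsPositive z → IsPositive (y * z)
  *-positive (e , es , y≈) (f , fs , z≈) =
    e +ᵉ f , map (e +ᵉ_) fs ++ cartesianProductWith _+ᵉ_ es (f ∷ fs) , trans (*-cong y≈ z≈) (sym (value-* (e ∷ es) (f ∷ fs)))

  private
    unit : ∀ {k} → Fin k → Vec ℕ k
    unit zero    = 1 Vec.∷ Vec.replicate _ 0
    unit (suc i) = 0 Vec.∷ unit i

    monomial-unit : ∀ {k} (y : Vector Carrier k) i → monomial K y (unit i) ≈ y i
    monomial-unit {suc k} y zero = trans (*-cong (*-identityʳ _)
      (trans (Product.sum-cong-≋ {k} (λ i → reflexive (≡.cong (y (suc i) ^_) (Vecₚ.lookup-replicate i 0))))
             (Product.sum-replicate-zero k))) (*-identityʳ _)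
    monomial-unit {suc k} y (suc i) = trans (*-identityˡ _) (monomial-unit (y ∘ suc) i)

  variable-positive : ∀ i → IsPositive (x i)
  variable-positive i = unit i , [] , sym (trans (+-identityʳ _) (monomial-unit x i))

  -- Written as y q = p and not as p / q, so that no inverse occurs before denominators are known to
  -- be nonzero.
  IsPositiveFraction : Carrier → Set _
  IsPositiveFraction y = ∃[ p ] ∃[ q ] IsPositive p × IsPositive q × y * q ≈ p

  positive⇒fraction : ∀ {y z} → y ≈ z → IsPositive z → IsPositiveFraction y
  positive⇒fraction y≈z z>0 = _ , 1# , z>0 , 1-positive , trans (*-identityʳ _) y≈z

  *-fraction : ∀ {y z} → IsPositiveFraction y → IsPositiveFraction z → IsPositiveFraction (y * z)
  *-fraction (_ , _ , p>0 , q>0 , yq≈p) (_ , _ , p′>0 , q′>0 , zq′≈p′) =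
    _ , _ , *-positive p>0 p′>0 , *-positive q>0 q′>0
    , trans (interchange _ _ _ _) (*-cong yq≈p zq′≈p′)

  +-fraction : ∀ {y z} → IsPositiveFraction y → IsPositiveFraction z → IsPositiveFraction (y + z)
  +-fraction {y} {z} (p , q , p>0 , q>0 , yq≈p) (p′ , q′ , p′>0 , q′>0 , zq′≈p′) =
    p * q′ + p′ * q , q * q′ , +-positive (*-positive p>0 q′>0) (*-positive p′>0 q>0)
    , *-positive q>0 q′>0 , (begin
      (y + z) * (q * q′)               ≈⟨ distribʳ _ _ _ ⟩
      y * (q * q′) + z * (q * q′)      ≈⟨ +-cong (sym (*-assoc _ _ _)) (trans (*-congˡ (*-comm _ _)) (sym (*-assoc _ _ _))) ⟩
      y * q * q′ + z * q′ * q          ≈⟨ +-cong (*-congʳ yq≈p) (*-congʳ zq′≈p′) ⟩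
      p * q′ + p′ * q ∎)

  -- From y = p / q and w = p′ / q′ the relation z y = w suggests z = p′ q / (p q′). This is the
  -- division performed at each step of the Q-system.
  fraction-quotient : ∀ {y z w} → IsPositiveFraction y → IsPositiveFraction w → z * y ≈ w → IsPositiveFraction z
  fraction-quotient {y} {z} {w} (p , q , p>0 , q>0 , yq≈p) (p′ , q′ , p′>0 , q′>0 , wq′≈p′) zy≈w =
    p′ * q , p * q′ , *-positive p′>0 q>0 , *-positive p>0 q′>0 , (begin
      z * (p * q′)         ≈⟨ *-congˡ (*-congʳ yq≈p) ⟨
      z * (y * q * q′)     ≈⟨ *-congˡ (*-assoc _ _ _) ⟩
      z * (y * (q * q′))   ≈⟨ *-assoc _ _ _ ⟨
      z * y * (q * q′)     ≈⟨ *-cong zy≈w (*-comm _ _) ⟩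
      w * (q′ * q)         ≈⟨ *-assoc _ _ _ ⟨
      w * q′ * q           ≈⟨ *-congʳ wq′≈p′ ⟩
      p′ * q ∎)

  module _ (independent : AlgebraicallyIndependent K x) where

    terms-≉0 : ∀ ts → Unique (map proj₁ ts) → ts ≢ [] → ¬ termsValue ts ≈ 0#
    terms-≉0 []       _    ts≢[] _   = ts≢[] ≡.refl
    terms-≉0 (s ∷ ts) uniq _     v≈0
      -- Independence would make the coefficient of the first term vanish, but it is a successor.
      with () ← independent (proj₁ ∘ lookup (s ∷ ts)) (λ i → pos (suc (proj₂ (lookup (s ∷ ts) i))))
                  (exponents-injective (s ∷ ts) uniq) (trans (sum-terms (s ∷ ts)) v≈0) zero

    positive-≉0 : ∀ {y} → IsPositive y → ¬ y ≈ 0#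
    positive-≉0 (e , es , y≈) y≈0 =
      terms-≉0 (collect (e ∷ es)) (collect-unique (e ∷ es)) (insert-≢[] e (collect es))
        (trans (collect-value (e ∷ es)) (trans (sym y≈) y≈0))

    fraction-≉0 : ∀ {y} → IsPositiveFraction y → ¬ y ≈ 0#
    fraction-≉0 (p , q , p>0 , q>0 , yq≈p) y≈0 =
      positive-≉0 p>0 (trans (sym yq≈p) (trans (*-congʳ y≈0) (zeroˡ q)))

module _ (K : Field c ℓ) {r : ℕ} (R : ℕ → ℤ → Field.Carrier K) (Q : IsQSystem K r R) where
  open Field K hiding (zero)
  open IsQSystem Q
  open PositiveElements K (initialData K r R)

  private
    boundary : ∀ {α} n → (α ≡ 0 → IsPositiveFraction (R α n)) → (α ≡ suc r → IsPositiveFraction (R α n)) →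
      (1 ≤ α → α ≤ r → IsPositiveFraction (R α n)) → α ≤ suc r → IsPositiveFraction (R α n)
    boundary {zero}  n bottom _ _ _ = bottom ≡.refl
    boundary {suc α} n _ top mid α≤ with suc α ℕₚ.≟ suc r
    ... | yes eq = top eq
    ... | no ¬eq = mid (s≤s z≤n) (ℕₚ.≤-pred (ℕₚ.≤∧≢⇒< α≤ ¬eq))

    fraction : ∀ {α} n → (1 ≤ α → α ≤ r → IsPositiveFraction (R α n)) → α ≤ suc r → IsPositiveFraction (R α n)
    fraction n = boundary n (λ { ≡.refl → positive⇒fraction (lower n) 1-positive })
                            (λ { ≡.refl → positive⇒fraction (upper n) 1-positive })

    label-fromℕ< : ∀ {α} (α<r : α < r) → suc α ≡ label (fromℕ< α<r)
    label-fromℕ< α<r = ≡.cong suc (≡.sym (Finₚ.toℕ-fromℕ< α<r))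

  -- Solved for R_{α,n+1}, the relation involves sums, products and one division, with no
  -- subtraction, so positivity propagates upwards from n = 0 and n = 1.
  R-fraction : ∀ n {α} → α ≤ suc r → IsPositiveFraction (R α (pos n))
  R-fraction zero = fraction (pos 0) λ { (s≤s _) α<r → positive⇒fraction
    (reflexive (≡.trans (≡.cong (λ k → R k (pos 0)) (label-fromℕ< α<r))
      (≡.sym (lookup-++ˡ (λ i → R (label i) 0ℤ) (λ i → R (label i) 1ℤ) (fromℕ< α<r)))))
    (variable-positive (fromℕ< α<r ↑ˡ r)) }
  R-fraction (suc zero) = fraction (pos 1) λ { (s≤s _) α<r → positive⇒fraction
    (reflexive (≡.trans (≡.cong (λ k → R k (pos 1)) (label-fromℕ< α<r))
      (≡.sym (lookup-++ʳ {m = r} (λ i → R (label i) 0ℤ) (λ i → R (label i) 1ℤ) (fromℕ< α<r)))))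
    (variable-positive (r ↑ʳ fromℕ< α<r)) }
  R-fraction (suc (suc n)) {α} = fraction (pos (suc (suc n))) λ 1≤α α≤r →
    fraction-quotient (R-fraction n (ℕₚ.m≤n⇒m≤1+n α≤r))
      (+-fraction (*-fraction (R-fraction (suc n) (ℕₚ.m≤n⇒m≤1+n α≤r)) (R-fraction (suc n) (ℕₚ.m≤n⇒m≤1+n α≤r)))
                  (*-fraction (R-fraction (suc n) (s≤s α≤r))
                              (R-fraction (suc n) (ℕₚ.m≤n⇒m≤1+n (ℕₚ.≤-trans ℕₚ.pred[n]≤n α≤r)))))
      -- At the index `pos (suc n)` the lower neighbour computes to `pos n`; the upper one is n + 1
      -- + 1 in the wrong order.
      (trans (*-congʳ (reflexive (≡.cong (R α ∘ pos) (ℕₚ.+-comm 1 (suc n)))))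
             (relation α (pos (suc n)) 1≤α α≤r))

  R-≉0 : AlgebraicallyIndependent K (initialData K r R) → ∀ n {α} → α ≤ suc r → ¬ R α (pos n) ≈ 0#
  R-≉0 independent n α≤ = fraction-≉0 independent (R-fraction n α≤)

-- The transfer matrix

interval≡iterate : ∀ lo hi {n} → suc hi ≡ lo ℕ.+ n → [ lo ⋯ hi ] ≡ iterate suc lo n
interval≡iterate lo hi {n} eq = ≡.trans
  (≡.cong (applyUpTo (lo ℕ.+_)) (≡.trans (≡.cong (_∸ lo) eq) (ℕₚ.m+n∸m≡n lo n)))
  (applyUpTo≡iterate n (λ _ → ≡.refl))

module _ {segs c d xs} (B : BlockReversal segs c d xs) where
  open BlockReversal B

  blockReversal-unique : Unique xs
  blockReversal-unique = ↭ₛₚ.Unique-resp-↭ (≡.setoid ℕ) (↭⇒↭ₛ (↭-sym permutation))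
    (unique-applyDownFrom⁺ (c ℕ.+_) d λ {i} {j} j<i _ eq →
      ℕₚ.<⇒≢ j<i (ℕₚ.+-cancelˡ-≡ c j i (≡.sym eq)))

  blockReversal-∈ : ∀ {j} → c ≤ j → j < c ℕ.+ d → j ∈ xs
  blockReversal-∈ c≤j j<c+d = ↭ₚ.∈-resp-↭ (↭-sym permutation) (∈-descending c≤j j<c+d)

  blockReversal-⊆ : ∀ {α β} b k → (α , β) ∈ segs → α ≤ suc β → α ≤ b → b ℕ.+ k ≤ suc β →
    iterate suc b k ⊆ xs
  blockReversal-⊆ {α} {β} b k s∈ α≤1+β α≤b b+k≤ = ⊆-trans
    (iterate-⊆ k (suc β ∸ α) α≤b (≡.subst (b ℕ.+ k ≤_) (≡.sym (ℕₚ.m+[n∸m]≡n α≤1+β)) b+k≤))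
    (block s∈)

module ListSums (A : CommutativeRing c ℓ) where
  open CommutativeRing A hiding (zero)
  open SemiringSum semiring using (sum; sum-cong-≋; sum-replicate-zero)

  sum-prefix : ∀ {n} (φ : ℕ → Carrier) (g : ℕ → ℕ) h (v : Fin n → Carrier) → h ≤ n →
    (∀ k → toℕ k < h → v k ≈ 1#) → (∀ k → h ≤ toℕ k → v k ≈ 0#) →
    sum (λ k → φ (g (toℕ k)) * v k) ≈ foldr _+_ 0# (map φ (applyUpTo g h))
  sum-prefix {n} φ g zero v _ _ v≈0 = trans
    (sum-cong-≋ {n} (λ k → trans (*-congˡ (v≈0 k z≤n)) (zeroʳ _))) (sum-replicate-zero n)
  sum-prefix {suc n} φ g (suc h) v (s≤s h≤n) v≈1 v≈0 = +-cong
    (trans (*-congˡ (v≈1 zero (s≤s z≤n))) (*-identityʳ _))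
    (sum-prefix φ (g ∘ suc) h (v ∘ suc) h≤n (λ k → v≈1 (suc k) ∘ s≤s) (λ k → v≈0 (suc k) ∘ s≤s))

module FieldProducts (K : Field c ℓ) where
  open Field K hiding (zero)
  open FieldProperties K
  open SetoidReasoning setoid
  open CommutativeSemigroupProperties *-commutativeSemigroup using (interchange)

  listProduct : List Carrier → Carrier
  listProduct = foldr _*_ 1#

  product-≉0 : ∀ (y : ℕ → Carrier) b k → (∀ i → b ≤ i → i < b ℕ.+ k → ¬ y i ≈ 0#) →
    ¬ listProduct (map y (iterate suc b k)) ≈ 0#
  product-≉0 y b zero    y≉0 = 1≉0
  product-≉0 y b (suc k) y≉0 = *-≉0 (y≉0 b ℕₚ.≤-refl (ℕₚ.m<m+n b ℕ.z<s))
    (product-≉0 y (suc b) k (λ i b<i i< → y≉0 i (ℕₚ.<⇒≤ b<i) (≡.subst (i <_) (≡.sym (ℕₚ.+-suc b k)) i<)))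

  product-/ : ∀ (x y : ℕ → Carrier) b k → (∀ i → b ≤ i → i < b ℕ.+ k → ¬ y i ≈ 0#) →
    listProduct (map (λ i → x i / y i) (iterate suc b k)) * listProduct (map y (iterate suc b k))
      ≈ listProduct (map x (iterate suc b k))
  product-/ x y b zero    y≉0 = *-identityˡ 1#
  product-/ x y b (suc k) y≉0 = trans (interchange _ _ _ _) (*-cong
    (trans (*-comm _ _) (*-/-cancel (x b) (y≉0 b ℕₚ.≤-refl (ℕₚ.m<m+n b ℕ.z<s))))
    (product-/ x y (suc b) k (λ i b<i i< → y≉0 i (ℕₚ.<⇒≤ b<i) (≡.subst (i <_) (≡.sym (ℕₚ.+-suc b k)) i<))))

  -- The factor y b is the scaling of row b by `D`. It cancels the first denominator, which is why
  -- the denominator of a descending edge starts one index after its numerator.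
  *-product-/ : ∀ (x y : ℕ → Carrier) b k → (∀ i → b ≤ i → i < b ℕ.+ suc k → ¬ y i ≈ 0#) →
    y b * listProduct (map (λ i → x i / y i) (iterate suc b (suc k)))
      ≈ listProduct (map x (iterate suc b (suc k))) / listProduct (map y (iterate suc (suc b) k))
  *-product-/ x y b k y≉0 = /-unique
    (product-≉0 y (suc b) k (λ i b<i i< → y≉0 i (ℕₚ.<⇒≤ b<i) (≡.subst (i <_) (≡.sym (ℕₚ.+-suc b k)) i<)))
    (trans (trans (*-congʳ (*-comm _ _)) (*-assoc _ _ _)) (product-/ x y b (suc k) y≉0))

at-nonneg : ∀ {r} (m : Vector ℤ r) → (∀ i → 0ℤ ℤ.≤ m i) → ∀ α → 0ℤ ℤ.≤ at m α
at-nonneg m m≥0 zero = ℤₚ.≤-refl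
at-nonneg {r} m m≥0 (suc k) with k ℕₚ.<? r
... | yes k<r = m≥0 (fromℕ< k<r)
... | no  _   = ℤₚ.≤-refl

module _ (K : Field c ℓ) {r : ℕ} (m : Vector ℤ r) (R : ℕ → ℤ → Field.Carrier K)
  (m≥0 : ∀ i → 0ℤ ℤ.≤ m i) (R≉0 : ∀ n {α} → α ≤ suc r → ¬ Field._≈_ K (R α (pos n)) (Field.0# K)) where
  open Field K using (_≈_; 0#)
  open Compactified K m R using (lam; yOdd)
  open FieldProperties K

  lam-≉0 : ∀ {α n} → 0ℤ ℤ.≤ n → α ≤ suc r → ¬ lam α n ≈ 0#
  lam-≉0 {n = pos n} (+≤+ _) α≤ = /-≉0 (R≉0 (n ℕ.+ 1) α≤) (R≉0 n α≤)

  -- Every R in this quotient has time index m or m + 1 for a value m of `at m`, and these values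
  -- are nonnegative, including the default 0 outside the path.
  yOdd-≉0 : ∀ α → α ≤ suc r → ¬ yOdd α ≈ 0#
  yOdd-≉0 α α≤ = /-≉0 (lam-≉0 (at-nonneg m m≥0 α) α≤)
    (lam-≉0 (at-nonneg m m≥0 (ℕ.pred α)) (ℕₚ.≤-trans ℕₚ.pred[n]≤n α≤))

module TransferMatrix (K : Field c ℓ) {r : ℕ} (m : Vector ℤ r) (R : ℕ → ℤ → Field.Carrier K)
  (yOdd≉0 : ∀ i → i ≤ suc r → ¬ Field._≈_ K (Compactified.yOdd K m R i) (Field.0# K)) where

  private
    S : CommutativeRing _ _
    S = SeriesProperties.seriesCommutativeRing (Field.commutativeRing K)
    module K = Field K
  open CommutativeRing S hiding (zero)
  open Compactified K m R hiding (_≈ₛ_; _+ₛ_)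
  open SeriesProperties (Field.commutativeRing K) using (const-*)
  open MatrixProperties S (suc r)
  open ElementaryMatrices S (suc r)
  open ConstantMatrices (Field.commutativeRing K) (suc r)
  open FieldProducts K
  open RawSemiringDefs (RawRing.rawSemiring seriesRing) using (_^_)
  open RingProperties (CommutativeRing.ring S) using (-‿distribˡ-*)
  open SetoidReasoning setoid

  const-cong : ∀ {x y} → x K.≈ y → const x ≈ const y
  const-cong x≈y zero    = x≈y
  const-cong x≈y (suc _) = K.refl

  const-homo-* : ∀ x y → const x * const y ≈ const (x K.* y)
  const-homo-* x y zero    = const-* x (const y) zero
  const-homo-* x y (suc k) = K.trans (const-* x (const y) (suc k)) (K.zeroʳ x)

  chainProduct-const : ∀ (x : ℕ → K.Carrier) b k →
    chainProduct (const ∘ x) b k ≈ const (listProduct (map x (iterate suc b k)))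
  chainProduct-const x b zero    = refl
  chainProduct-const x b (suc k) = trans (*-congˡ {x = const (x b)} (chainProduct-const x (suc b) k))
    (const-homo-* (x b) (listProduct (map x (iterate suc (suc b) k))))

  chainProduct-replicate : ∀ x b k → chainProduct (λ _ → x) b k ≈ x ^ k
  chainProduct-replicate x b zero    = refl
  chainProduct-replicate x b (suc k) = *-congˡ {x = x} (chainProduct-replicate x (suc b) k)

  private
    module σR = BlockReversal (maximalSegments-reversal 1ℤ m)
    module τR = BlockReversal (maximalSegments-reversal -1ℤ m)

    unique-σ : Unique (σ m)
    unique-σ = blockReversal-unique (maximalSegments-reversal 1ℤ m)

    unique-τ : Unique (τ m)
    unique-τ = blockReversal-unique (maximalSegments-reversal -1ℤ m)

    label≤ : ∀ (a : Vertex) → label a ≤ suc r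
    label≤ = Finₚ.toℕ<n

  minusOne : Series
  minusOne = - 1#

  f⁻¹ : ℕ → Matrix
  f⁻¹ i = I ⊕ minusOne • E (suc i) i

  F⁻¹ : Matrix
  F⁻¹ = ∏ʳ (map f⁻¹ (σ m))

  f≋transvection : ∀ i → f i ≋ I ⊕ 1# • E (suc i) i
  f≋transvection i a b = +-congˡ {x = I a b} (sym (*-identityˡ (E (suc i) i a b)))

  F·F⁻¹ : F · F⁻¹ ≋ I
  F·F⁻¹ = ∏-inverse f f⁻¹ (λ i → ≋-trans
    (·-cong {N = f⁻¹ i} (f≋transvection i) ≋-refl)
    (transvection-inverse (ℕₚ.1+n≢n {i}) (-‿inverseʳ 1#))) (σ m)

  F⁻¹·F : F⁻¹ · F ≋ I
  F⁻¹·F = ∏ʳ-inverse f f⁻¹ (λ i → ≋-trans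
    (·-cong {f⁻¹ i} ≋-refl (f≋transvection i))
    (transvection-inverse (ℕₚ.1+n≢n {i}) (-‿inverseˡ 1#))) (σ m)

  F⁻¹-entry : ∀ b a → F⁻¹ b a ≈ chainSum (λ _ → minusOne) (label a) (label b) (σ m)
  F⁻¹-entry = lowerProduct (λ _ → minusOne) {f⁻¹} (λ _ → ≋-refl) (σ m)

  F⁻¹-> : ∀ {b a} → label b < label a → F⁻¹ b a ≈ 0#
  F⁻¹-> {b} {a} b<a = trans (F⁻¹-entry b a) (chainSum-> (λ _ → minusOne) (σ m) b<a)

  F⁻¹-diag : ∀ a → F⁻¹ a a ≈ 1#
  F⁻¹-diag a = trans (F⁻¹-entry a a) (chainSum-diag (λ _ → minusOne) (label a) (σ m))

  F⁻¹-⊆ : ∀ {b a} k → label b ≡ label a ℕ.+ k → iterate suc (label a) k ⊆ σ m → F⁻¹ b a ≈ minusOne ^ k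
  F⁻¹-⊆ {b} {a} k b≡a+k s = begin
    F⁻¹ b a                                                ≈⟨ F⁻¹-entry b a ⟩
    chainSum (λ _ → minusOne) (label a) (label b) (σ m)        ≡⟨ ≡.cong (λ j → chainSum (λ _ → minusOne) (label a) j (σ m)) b≡a+k ⟩
    chainSum (λ _ → minusOne) (label a) (label a ℕ.+ k) (σ m)  ≈⟨ chainSum-⊆ (λ _ → minusOne) (label a) k unique-σ s ⟩
    chainProduct (λ _ → minusOne) (label a) k                  ≈⟨ chainProduct-replicate minusOne (label a) k ⟩
    minusOne ^ k ∎

  coefficient : ℕ → K.Carrier
  coefficient i = yEven i K./ yOdd i

  DU-entry : ∀ b a → (D · U) b a ≈ const (yOdd (label b)) * chainSum (const ∘ coefficient) (label b) (label a) (τ m)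
  DU-entry b a = trans
    (dilations-∈ (const ∘ yOdd) [ 1 ⋯ suc r ] U b a
      (AllPairs.map ℕₚ.<⇒≢ (interval-ascending 1 (suc r)))
      (∈-applyUpTo⁺ suc (Finₚ.toℕ<n b)))
    (*-congˡ {x = const (yOdd (label b))} (upperProduct (const ∘ coefficient) (τ m) b a))

  DU-> : ∀ {b a} → label a < label b → (D · U) b a ≈ 0#
  DU-> {b} {a} a<b = trans (DU-entry b a) (trans
    (*-congˡ {x = const (yOdd (label b))} (chainSum-> (const ∘ coefficient) (τ m) a<b)) (zeroʳ (const (yOdd (label b)))))

  DU-diag : ∀ a → (D · U) a a ≈ const (yOdd (label a))
  DU-diag a = trans (DU-entry a a) (trans
    (*-congˡ {x = const (yOdd (label a))} (chainSum-diag (const ∘ coefficient) (label a) (τ m))) (*-identityʳ (const (yOdd (label a)))))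

  DU-⊆ : ∀ {b a} k → label a ≡ label b ℕ.+ suc k → iterate suc (label b) (suc k) ⊆ τ m →
    (D · U) b a ≈ const (listProduct (map yEven (iterate suc (label b) (suc k)))
                      K./ listProduct (map yOdd (iterate suc (suc (label b)) k)))
  DU-⊆ {b} {a} k a≡b+1+k s = begin
    (D · U) b a
      ≈⟨ DU-entry b a ⟩
    const (yOdd (label b)) * chainSum (const ∘ coefficient) (label b) (label a) (τ m)
      ≡⟨ ≡.cong (λ j → const (yOdd (label b)) * chainSum (const ∘ coefficient) (label b) j (τ m)) a≡b+1+k ⟩
    const (yOdd (label b)) * chainSum (const ∘ coefficient) (label b) (label b ℕ.+ suc k) (τ m)
      ≈⟨ *-congˡ {x = const (yOdd (label b))} (trans
           (chainSum-⊆ (const ∘ coefficient) (label b) (suc k) unique-τ s)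
           (chainProduct-const coefficient (label b) (suc k))) ⟩
    const (yOdd (label b)) * const (listProduct (map coefficient (iterate suc (label b) (suc k))))
      ≈⟨ const-homo-* _ _ ⟩
    const (yOdd (label b) K.* listProduct (map coefficient (iterate suc (label b) (suc k))))
      ≈⟨ const-cong (*-product-/ yEven yOdd (label b) k λ i _ i<a →
           yOdd≉0 i (ℕₚ.≤-trans (ℕₚ.<⇒≤ (≡.subst (i <_) (≡.sym a≡b+1+k) i<a)) (label≤ a))) ⟩
    const (listProduct (map yEven (iterate suc (label b) (suc k)))
        K./ listProduct (map yOdd (iterate suc (suc (label b)) k))) ∎

  I-diag : ∀ a → I a a ≈ 1#
  I-diag a = trans (I≈δ a a) (δ-refl (label a))

  I-≢ : ∀ {b a} → label b ≢ label a → I b a ≈ 0#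
  I-≢ {b} {a} b≢a = trans (I≈δ b a) (δ-≢ b≢a)

  -- Below the diagonal `D · U` vanishes, so a weight has to cancel the entry of `F⁻¹`. In `above`
  -- the roles are exchanged and the weight has to equal t times the entry of `D · U`.
  below : ∀ {b a} w → label a < label b → w + F⁻¹ b a ≈ 0# → w + F⁻¹ b a ≈ I b a + t * (D · U) b a
  below {b} {a} w a<b w≈ = begin
    w + F⁻¹ b a               ≈⟨ w≈ ⟩
    0#                        ≈⟨ +-identityˡ 0# ⟨
    0# + 0#                   ≈⟨ +-cong (I-≢ {b} {a} (ℕₚ.>⇒≢ a<b))
                                   (trans (*-congˡ {x = t} (DU-> {b} {a} a<b)) (zeroʳ t)) ⟨
    I b a + t * (D · U) b a ∎

  above : ∀ {b a} w → label b < label a → w ≈ t * (D · U) b a → w + F⁻¹ b a ≈ I b a + t * (D · U) b a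
  above {b} {a} w b<a w≈ = begin
    w + F⁻¹ b a               ≈⟨ +-cong w≈ (F⁻¹-> {b} {a} b<a) ⟩
    t * (D · U) b a + 0#      ≈⟨ +-comm _ _ ⟩
    0# + t * (D · U) b a      ≈⟨ +-congʳ (I-≢ {b} {a} (ℕₚ.<⇒≢ b<a)) ⟨
    I b a + t * (D · U) b a ∎

  -- An ascending edge from a to b carries the sign of b - a - 1, whereas the chain in `F⁻¹` has b -
  -- a letters.
  signs-cancel : ∀ k → minusOne ^ k + minusOne ^ suc k ≈ 0#
  signs-cancel k = trans (+-congˡ {x = minusOne ^ k} (trans (sym (-‿distribˡ-* 1# (minusOne ^ k)))
    (-‿cong (*-identityˡ (minusOne ^ k))))) (-‿inverseʳ (minusOne ^ k))

  desc-identity : ∀ {a b} α β p q (s∈ : (α , β) ∈ descents m) (q+2≤p : q ℕ.+ 2 ≤ p) (α+p≤1+β : α ℕ.+ p ≤ suc β)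
    (a≡α+p : label a ≡ α ℕ.+ p) (b≡α+q : label b ≡ α ℕ.+ q) → ∃[ o ] q ℕ.+ 2 ℕ.+ o ≡ p →
    weight (desc {a} {b} α β p q s∈ q+2≤p α+p≤1+β a≡α+p b≡α+q) + F⁻¹ b a ≈ I b a + t * (D · U) b a
  desc-identity {a} {b} α β p q s∈ _ α+p≤1+β a≡α+p b≡α+q (o , ≡.refl) = above {b} {a} _ (≡.subst₂ _<_ (≡.sym b≡α+q) (≡.sym a≡α+p) α+q<α+p)
    (*-congˡ {x = t} (begin
      const (listProduct (map yEven [ α ℕ.+ q ⋯ α ℕ.+ p ∸ 1 ]) K./ listProduct (map yOdd [ α ℕ.+ q ℕ.+ 1 ⋯ α ℕ.+ p ∸ 1 ]))
        ≡⟨ ≡.cong₂ (λ is js → const (listProduct (map yEven is) K./ listProduct (map yOdd js)))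
             -- With p = q + 2 + o the numerator has p - q = o + 2 factors and the denominator one
             -- fewer.
             (interval≡iterate (α ℕ.+ q) (α ℕ.+ p ∸ 1) {suc (suc o)} (≡.trans pred-top (top α q o)))
             (≡.trans (interval≡iterate (α ℕ.+ q ℕ.+ 1) (α ℕ.+ p ∸ 1) {suc o} (≡.trans pred-top (top′ α q o)))
               (≡.cong (λ i → iterate suc i (suc o)) (ℕₚ.+-comm (α ℕ.+ q) 1))) ⟩
      const (listProduct (map yEven (iterate suc (α ℕ.+ q) (suc (suc o))))
          K./ listProduct (map yOdd (iterate suc (suc (α ℕ.+ q)) (suc o))))
        ≡⟨ ≡.cong (λ i → const (listProduct (map yEven (iterate suc i (suc (suc o))))
          K./ listProduct (map yOdd (iterate suc (suc i) (suc o))))) b≡α+q ⟨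
      const (listProduct (map yEven (iterate suc (label b) (suc (suc o))))
          K./ listProduct (map yOdd (iterate suc (suc (label b)) (suc o))))
        ≈⟨ DU-⊆ {b} {a} (suc o) a≡ (blockReversal-⊆ (maximalSegments-reversal -1ℤ m) (label b) (suc (suc o)) s∈
             (ℕₚ.≤-trans (ℕₚ.m≤m+n α p) α+p≤1+β) (≡.subst (α ≤_) (≡.sym b≡α+q) (ℕₚ.m≤m+n α q))
             (≡.subst (_≤ suc β) (≡.trans (≡.sym a≡α+p) a≡) α+p≤1+β)) ⟨
      (D · U) b a ∎))
    where
    top : ∀ α q o → α ℕ.+ (q ℕ.+ 2 ℕ.+ o) ≡ α ℕ.+ q ℕ.+ suc (suc o)
    top = solve-∀
    top′ : ∀ α q o → α ℕ.+ (q ℕ.+ 2 ℕ.+ o) ≡ α ℕ.+ q ℕ.+ 1 ℕ.+ suc o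
    top′ = solve-∀
    a≡ : label a ≡ label b ℕ.+ suc (suc o)
    a≡ = ≡.trans a≡α+p (≡.trans (top α q o) (≡.cong (ℕ._+ suc (suc o)) (≡.sym b≡α+q)))
    α+q<α+p : α ℕ.+ q < α ℕ.+ p
    α+q<α+p = ≡.subst (α ℕ.+ q <_) (≡.sym (top α q o)) (ℕₚ.m<m+n (α ℕ.+ q) ℕ.z<s)
    pred-top : suc (α ℕ.+ p ∸ 1) ≡ α ℕ.+ p
    pred-top = ℕₚ.m+[n∸m]≡n (ℕₚ.≤-trans (s≤s z≤n) α+q<α+p)
  asc-identity : ∀ {a b} α β p q (s∈ : (α , β) ∈ ascents m) (q+2≤p : q ℕ.+ 2 ≤ p) (α+p≤1+β : α ℕ.+ p ≤ suc β)
    (a≡α+q : label a ≡ α ℕ.+ q) (b≡α+p : label b ≡ α ℕ.+ p) → ∃[ o ] q ℕ.+ 2 ℕ.+ o ≡ p →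
    weight (asc {a} {b} α β p q s∈ q+2≤p α+p≤1+β a≡α+q b≡α+p) + F⁻¹ b a ≈ I b a + t * (D · U) b a
  asc-identity {a} {b} α β p q s∈ _ α+p≤1+β a≡α+q b≡α+p (o , ≡.refl) = below {b} {a} (minusOne ^ (p ∸ q ∸ 1)) (≡.subst₂ _<_ (≡.sym a≡α+q) (≡.sym b≡α+p) α+q<α+p) (begin
    minusOne ^ (p ∸ q ∸ 1) + F⁻¹ b a
      ≡⟨ ≡.cong (λ k → minusOne ^ k + F⁻¹ b a) p∸q∸1 ⟩
    minusOne ^ suc o + F⁻¹ b a
      ≈⟨ +-congˡ {x = minusOne ^ suc o} (F⁻¹-⊆ {b} {a} (suc (suc o)) b≡
           (blockReversal-⊆ (maximalSegments-reversal 1ℤ m) (label a) (suc (suc o)) s∈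
             (ℕₚ.≤-trans (ℕₚ.m≤m+n α p) α+p≤1+β) (≡.subst (α ≤_) (≡.sym a≡α+q) (ℕₚ.m≤m+n α q))
             (≡.subst (_≤ suc β) (≡.trans (≡.sym b≡α+p) b≡) α+p≤1+β))) ⟩
    minusOne ^ suc o + minusOne ^ suc (suc o)
      ≈⟨ signs-cancel (suc o) ⟩
    0# ∎)
    where
    top : ∀ α q o → α ℕ.+ (q ℕ.+ 2 ℕ.+ o) ≡ α ℕ.+ q ℕ.+ suc (suc o)
    top = solve-∀
    b≡ : label b ≡ label a ℕ.+ suc (suc o)
    b≡ = ≡.trans b≡α+p (≡.trans (top α q o) (≡.cong (ℕ._+ suc (suc o)) (≡.sym a≡α+q)))
    α+q<α+p : α ℕ.+ q < α ℕ.+ p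
    α+q<α+p = ≡.subst (α ℕ.+ q <_) (≡.sym (top α q o)) (ℕₚ.m<m+n (α ℕ.+ q) ℕ.z<s)
    p∸q∸1 : p ∸ q ∸ 1 ≡ suc o
    p∸q∸1 = ≡.cong (_∸ 1) (≡.trans (≡.cong (_∸ q) (ℕₚ.+-assoc q 2 o)) (ℕₚ.m+n∸m≡n q (2 ℕ.+ o)))

  weight-identity : ∀ {a b} (e : Edge a b) → weight e + F⁻¹ b a ≈ I b a + t * (D · U) b a
  weight-identity {a} {b} (up b≡1+a) = below {b} {a} 1# (ℕₚ.≤-reflexive (≡.sym b≡1+a)) (begin
    -- A single letter is a chain in any order of `σ`, so upward edges need no segment.
    1# + F⁻¹ b a     ≈⟨ +-congˡ {x = 1#} (F⁻¹-⊆ {b} {a} 1 (≡.trans b≡1+a (≡.sym (ℕₚ.+-comm (label a) 1)))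
                          (from∈ (blockReversal-∈ (maximalSegments-reversal 1ℤ m) (s≤s z≤n)
                            (≡.subst (_≤ suc r) b≡1+a (label≤ b))))) ⟩
    1# + minusOne ^ 1    ≈⟨ signs-cancel 0 ⟩
    0# ∎)
  weight-identity {a} {b} (down a≡1+b) = above {b} {a} (t * const (yEven (label b)))
    (ℕₚ.≤-reflexive (≡.sym a≡1+b))
    (*-congˡ {x = t} (begin
      const (yEven (label b))
        -- The general formula for a chain of length one has an empty denominator; the units left by
        -- the empty products are inserted here.
        ≈⟨ const-cong (FieldProperties./-unique K {yEven (label b) K.* K.1#} {K.1#} K.1≉0 K.refl) ⟩
      const ((yEven (label b) K.* K.1#) K./ K.1#)
        ≈⟨ DU-⊆ {b} {a} 0 (≡.trans a≡1+b (≡.sym (ℕₚ.+-comm (label b) 1)))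
             (from∈ (blockReversal-∈ (maximalSegments-reversal -1ℤ m) (s≤s z≤n)
               (≡.subst (_≤ suc r) a≡1+b (label≤ a)))) ⟨
      (D · U) b a ∎))
  weight-identity {a} (loop ≡.refl) = begin
    t * const (yOdd (label a)) + F⁻¹ a a
      ≈⟨ +-cong (*-congˡ {x = t} (sym (DU-diag a))) (F⁻¹-diag a) ⟩
    t * (D · U) a a + 1#
      ≈⟨ +-comm _ _ ⟩
    1# + t * (D · U) a a
      ≈⟨ +-congʳ (I-diag a) ⟨
    I a a + t * (D · U) a a ∎
  weight-identity (desc α β p q s∈ q+2≤p α+p≤1+β a≡α+p b≡α+q) =
    desc-identity α β p q s∈ q+2≤p α+p≤1+β a≡α+p b≡α+q (ℕₚ.m≤n⇒∃[o]m+o≡n q+2≤p)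
  weight-identity (asc α β p q s∈ q+2≤p α+p≤1+β a≡α+q b≡α+p) =
    asc-identity α β p q s∈ q+2≤p α+p≤1+β a≡α+q b≡α+p (ℕₚ.m≤n⇒∃[o]m+o≡n q+2≤p)

  two-apart : ∀ {i j} → i < j → j ≢ suc i → suc (suc i) ≤ j
  two-apart i<j j≢1+i = ℕₚ.≤∧≢⇒< i<j (j≢1+i ∘ ≡.sym)

  -- A segment through all letters of the chain would supply an ascending edge. Otherwise some j is
  -- uncovered, so j + 1 precedes j in `σ` and breaks the chain.
  noAscent-vanishes : ∀ {a b} → ¬ Edge a b → label a < label b →
    chainSum (λ _ → minusOne) (label a) (label b) (σ m) ≈ 0#
  noAscent-vanishes {a} {b} ¬edge a<b = vanishes (ℕₚ.m≤n⇒∃[o]m+o≡n 2+a≤b)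
    where
    2+a≤b = two-apart a<b (¬edge ∘ up)
    vanishes : ∃[ k ] 2 ℕ.+ label a ℕ.+ k ≡ label b →
      chainSum (λ _ → minusOne) (label a) (label b) (σ m) ≈ 0#
    -- The letters are a, ..., b - 1 = a + k + 1, so a segment containing them reaches vertex b
    -- through its bound β + 1.
    vanishes (k , 2+a+k≡b) = [ covered , uncovered ]′ (covered⊎uncovered (label a) k (maximalSegments-sorted 1ℤ m))
      where
      b≡ : suc (label a ℕ.+ suc k) ≡ label b
      b≡ = ≡.trans (≡.cong suc (ℕₚ.+-suc (label a) k)) 2+a+k≡b
      covered : ∃[ α ] ∃[ β ] (α , β) ∈ ascents m × α ≤ label a × label a ℕ.+ suc k ≤ β →
        chainSum (λ _ → minusOne) (label a) (label b) (σ m) ≈ 0#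
      covered (α , β , s∈ , α≤a , a+1+k≤β) = contradiction
        (asc α β (label b ∸ α) (label a ∸ α) s∈
          (ℕₚ.+-cancelˡ-≤ α _ _ (≡.subst₂ _≤_
            (≡.trans (≡.cong (ℕ._+ 2) (≡.sym (ℕₚ.m+[n∸m]≡n α≤a))) (ℕₚ.+-assoc α (label a ∸ α) 2))
            (≡.sym α+p) (≡.subst (_≤ label b) (ℕₚ.+-comm 2 (label a)) 2+a≤b)))
          (≡.subst (_≤ suc β) (≡.sym α+p) (≡.subst (_≤ suc β) b≡ (s≤s a+1+k≤β)))
          (≡.sym (ℕₚ.m+[n∸m]≡n α≤a)) (≡.sym α+p)) ¬edge
        where
        α+p : α ℕ.+ (label b ∸ α) ≡ label b
        α+p = ℕₚ.m+[n∸m]≡n (ℕₚ.≤-trans α≤a (ℕₚ.<⇒≤ a<b))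
      uncovered : ∃[ j ] label a ≤ j × j < label a ℕ.+ suc k × Uncovered j (ascents m) →
        chainSum (λ _ → minusOne) (label a) (label b) (σ m) ≈ 0#
      uncovered (j , a≤j , j< , unc) = chainSum-broken (λ _ → minusOne) unique-σ a≤j j+1<b
        (σR.broken (ℕₚ.≤-trans (s≤s z≤n) a≤j) (ℕₚ.<-≤-trans j+1<b (label≤ b)) unc)
        where
        j+1<b : suc j < label b
        j+1<b = ≡.subst (suc j <_) b≡ (s≤s j<)

  noDescent-vanishes : ∀ {a b} → ¬ Edge a b → label b < label a →
    chainSum (const ∘ coefficient) (label b) (label a) (τ m) ≈ 0#
  noDescent-vanishes {a} {b} ¬edge b<a = vanishes (ℕₚ.m≤n⇒∃[o]m+o≡n 2+b≤a)
    where
    2+b≤a = two-apart b<a (¬edge ∘ down)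
    vanishes : ∃[ k ] 2 ℕ.+ label b ℕ.+ k ≡ label a →
      chainSum (const ∘ coefficient) (label b) (label a) (τ m) ≈ 0#
    vanishes (k , 2+b+k≡a) = [ covered , uncovered ]′ (covered⊎uncovered (label b) k (maximalSegments-sorted -1ℤ m))
      where
      a≡ : suc (label b ℕ.+ suc k) ≡ label a
      a≡ = ≡.trans (≡.cong suc (ℕₚ.+-suc (label b) k)) 2+b+k≡a
      covered : ∃[ α ] ∃[ β ] (α , β) ∈ descents m × α ≤ label b × label b ℕ.+ suc k ≤ β →
        chainSum (const ∘ coefficient) (label b) (label a) (τ m) ≈ 0#
      covered (α , β , s∈ , α≤b , b+1+k≤β) = contradiction
        (desc α β (label a ∸ α) (label b ∸ α) s∈
          (ℕₚ.+-cancelˡ-≤ α _ _ (≡.subst₂ _≤_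
            (≡.trans (≡.cong (ℕ._+ 2) (≡.sym (ℕₚ.m+[n∸m]≡n α≤b))) (ℕₚ.+-assoc α (label b ∸ α) 2))
            (≡.sym α+p) (≡.subst (_≤ label a) (ℕₚ.+-comm 2 (label b)) 2+b≤a)))
          (≡.subst (_≤ suc β) (≡.sym α+p) (≡.subst (_≤ suc β) a≡ (s≤s b+1+k≤β)))
          (≡.sym α+p) (≡.sym (ℕₚ.m+[n∸m]≡n α≤b))) ¬edge
        where
        α+p : α ℕ.+ (label a ∸ α) ≡ label a
        α+p = ℕₚ.m+[n∸m]≡n (ℕₚ.≤-trans α≤b (ℕₚ.<⇒≤ b<a))
      uncovered : ∃[ j ] label b ≤ j × j < label b ℕ.+ suc k × Uncovered j (descents m) →
        chainSum (const ∘ coefficient) (label b) (label a) (τ m) ≈ 0#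
      uncovered (j , b≤j , j< , unc) = chainSum-broken (const ∘ coefficient) unique-τ b≤j j+1<a
        (τR.broken (ℕₚ.≤-trans (s≤s z≤n) b≤j) (ℕₚ.<-≤-trans j+1<a (label≤ a)) unc)
        where
        j+1<a : suc j < label a
        j+1<a = ≡.subst (suc j <_) a≡ (s≤s j<)

  noEdge-identity : ∀ {a b} → ¬ Edge a b → 0# + F⁻¹ b a ≈ I b a + t * (D · U) b a
  noEdge-identity {a} {b} ¬edge = split (ℕₚ.<-cmp (label a) (label b))
    where
    split : Tri (label a < label b) (label a ≡ label b) (label b < label a) →
      0# + F⁻¹ b a ≈ I b a + t * (D · U) b a
    split (tri≈ _ a≡b _) = contradiction (loop (Finₚ.toℕ-injective (ℕₚ.suc-injective a≡b))) ¬edge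
    split (tri< a<b _ _) = below {b} {a} 0# a<b (trans (+-identityˡ (F⁻¹ b a))
      (trans (F⁻¹-entry b a) (noAscent-vanishes ¬edge a<b)))
    split (tri> _ _ b<a) = above {b} {a} 0# b<a (sym (trans (*-congˡ {x = t} (trans (DU-entry b a)
      (trans (*-congˡ {x = const (yOdd (label b))} (noDescent-vanishes ¬edge b<a))
        (zeroʳ (const (yOdd (label b))))))) (zeroʳ t)))

  T′-identity : ∀ b a → T′ b a + F⁻¹ b a ≈ I b a + t * (D · U) b a
  T′-identity b a =
    T′-cases K m R (λ w → w + F⁻¹ b a ≈ I b a + t * (D · U) b a) b a weight-identity noEdge-identity

-- Inverses and the first row

module Resolvents (A : CommutativeRing c ℓ) (n : ℕ) where
  open CommutativeRing A hiding (zero)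
  open Matrices rawRing n
  open MatrixProperties A n
  open SetoidReasoning setoid

  private
    cross-difference : ∀ {x y z w} → x + y ≈ z + w → z + - x ≈ y + - w
    cross-difference {x} {y} {z} {w} eq = begin
      z + - x                ≈⟨ +-congʳ (trans (+-congˡ (-‿inverseʳ w)) (+-identityʳ z)) ⟨
      z + (w + - w) + - x    ≈⟨ +-congʳ (+-assoc z w (- w)) ⟨
      z + w + - w + - x      ≈⟨ +-congʳ (+-congʳ (trans (sym eq) (+-comm x y))) ⟩
      y + x + - w + - x      ≈⟨ xy∙z≈xz∙y (y + x) (- w) (- x) ⟩
      y + x + - x + - w      ≈⟨ +-congʳ (trans (+-assoc y x (- x)) (trans (+-congˡ (-‿inverseʳ x)) (+-identityʳ y))) ⟩
      y + - w ∎
      where open CommutativeSemigroupProperties +-commutativeSemigroup using (xy∙z≈xz∙y)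

  factorisation : ∀ {F G T H} x → F · G ≋ I → (∀ a b → T a b + G a b ≈ I a b + x * H a b) →
    F · (I ⊖ T) ≋ I ⊖ x • (F · H)
  factorisation {F} {G} {T} {H} x FG eq =
    ≋-trans (·-cong (≋-refl {F}) (λ a b → cross-difference (eq a b)))
      (≋-trans (·-distribˡ-⊖ F G (x • H)) (⊖-cong FG (•-·ʳ x F H)))

  -- One side is (Y F) B = Y C = I. For the other, B Y = G F B Y = G C Y = G, hence B (Y F) = G F =
  -- I.
  inverse-factor : ∀ {F G B C Y} → F · G ≋ I → G · F ≋ I → F · B ≋ C →
    Y IsInverseOf C → (Y · F) IsInverseOf B
  inverse-factor {F} {G} {B} {C} {Y} FG GF FB (YC , CY) =
      ≋-trans (·-assoc Y F B) (≋-trans (·-cong (≋-refl {Y}) FB) YC)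
    , ≋-trans (≋-sym (·-assoc B Y F)) (≋-trans (·-cong BY≋G (≋-refl {F})) GF)
    where
    BY≋G : B · Y ≋ G
    BY≋G = ≋-trans (·-cong (≋-trans (≋-sym (·-identityˡ B)) (·-cong (≋-sym GF) (≋-refl {B}))) (≋-refl {Y}))
      (≋-trans (·-cong (≋-trans (·-assoc G F B) (·-cong (≋-refl {G}) FB)) (≋-refl {Y}))
        (≋-trans (·-assoc G C Y) (≋-trans (·-cong (≋-refl {G}) CY) (·-identityʳ G))))

  inverse-unique : ∀ {B X Z} → X IsInverseOf B → Z IsInverseOf B → X ≋ Z
  inverse-unique {B} {X} {Z} (XB , _) (_ , BZ) =
    ≋-trans (≋-sym (·-identityʳ X)) (≋-trans (·-cong (≋-refl {X}) (≋-sym BZ))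
      (≋-trans (≋-sym (·-assoc X B Z)) (≋-trans (·-cong XB (≋-refl {Z})) (·-identityˡ Z))))

module FirstRows (A : CommutativeRing c ℓ) (n : ℕ) where
  open CommutativeRing A hiding (zero)
  open Matrices rawRing (suc n)
  open SemiringSum semiring using (sum-cong-≋)

  entry-label : ∀ M i j → entry M (label i) (label j) ≡ M i j
  entry-label M i j with toℕ i ℕₚ.<? suc n | toℕ j ℕₚ.<? suc n
  ... | yes i< | yes j< = ≡.cong₂ M (Finₚ.fromℕ<-toℕ i i<) (Finₚ.fromℕ<-toℕ j j<)
  ... | no i≮  | _      = contradiction (Finₚ.toℕ<n i) i≮
  ... | yes _  | no j≮  = contradiction (Finₚ.toℕ<n j) j≮

  -- The first column of F is the indicator of the rows 1, ..., h, so multiplying by it truncates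
  -- the row sum of Y.
  first-entry : ∀ {X Y F : Matrix} h → X ≋ Y · F → h ≤ suc n →
    (∀ k → toℕ k < h → F k zero ≈ 1#) → (∀ k → h ≤ toℕ k → F k zero ≈ 0#) →
    entry X 1 1 ≈ listSum (map (entry Y 1) [ 1 ⋯ h ])
  first-entry {X} {Y} {F} h X≋YF h≤ F≈1 F≈0 = trans (reflexive (entry-label X zero zero))
    (trans (X≋YF zero zero)
      (trans (sum-cong-≋ {suc n} (λ k → *-congʳ {x = F k zero} (reflexive (≡.sym (entry-label Y zero k)))))
        (ListSums.sum-prefix A (entry Y 1) suc h (λ k → F k zero) h≤ F≈1 F≈0)))

module FirstColumn (K : Field c ℓ) {r : ℕ} (m : Vector ℤ r) (R : ℕ → ℤ → Field.Carrier K) where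
  private
    S : CommutativeRing _ _
    S = SeriesProperties.seriesCommutativeRing (Field.commutativeRing K)
  open CommutativeRing S hiding (zero)
  open Compactified K m R hiding (_≈ₛ_; _+ₛ_)
  open MatrixProperties S (suc r)
  open ElementaryMatrices S (suc r)
  open BlockReversal (maximalSegments-reversal 1ℤ m)
  open SetoidReasoning setoid

  unique-reverse-σ : Unique (reverse (σ m))
  unique-reverse-σ = ↭ₛₚ.Unique-resp-↭ (≡.setoid ℕ) (↭⇒↭ₛ (↭-sym (↭ₚ.↭-reverse (σ m))))
    (blockReversal-unique (maximalSegments-reversal 1ℤ m))

  -- `F` multiplies lower transvections in the order of `σ`, and `lowerProduct` treats the opposite
  -- order, so chains are sought in the reversed list: for column 1, descending subsequences of `σ`
  -- itself.
  F-entry : ∀ b a → F b a ≈ chainSum (λ _ → 1#) (label a) (label b) (reverse (σ m))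
  F-entry b a = begin
    ∏ (map f (σ m)) b a
      ≈⟨ ∏≋∏ʳ-reverse (map f (σ m)) b a ⟩
    ∏ʳ (reverse (map f (σ m))) b a
      ≡⟨ ≡.cong (λ Ms → ∏ʳ Ms b a) (reverse-map f (σ m)) ⟨
    ∏ʳ (map f (reverse (σ m))) b a
      ≈⟨ lowerProduct (λ _ → 1#) {f} (λ i a b → +-congˡ {x = I a b} (sym (*-identityˡ (E (suc i) i a b))))
           (reverse (σ m)) b a ⟩
    chainSum (λ _ → 1#) (label a) (label b) (reverse (σ m)) ∎

  chainProduct-1 : ∀ b k → chainProduct (λ _ → 1#) b k ≈ 1#
  chainProduct-1 b zero    = refl
  chainProduct-1 b (suc k) = trans (*-identityˡ (chainProduct (λ _ → 1#) (suc b) k)) (chainProduct-1 (suc b) k)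

  -- The letters 1, ..., b - 1 do not exceed the start of any ascent, so `σ` keeps them in
  -- descending order and the chain exists.
  F-initial : ∀ b → All (λ s → label b ≤ suc (proj₁ s)) (ascents m) → F b zero ≈ 1#
  F-initial b b≤α = trans (F-entry b zero) (trans
    (chainSum-⊆ (λ _ → 1#) 1 (toℕ b) unique-reverse-σ
      (≡.subst (_⊆ reverse (σ m))
        (≡.trans (reverse-applyDownFrom suc (toℕ b)) (applyUpTo≡iterate (toℕ b) (λ _ → ≡.refl)))
        (reverse⁺ (initial (toℕ b) (ℕₚ.≤-pred (Finₚ.toℕ<n b)) b≤α))))
    (chainProduct-1 1 (toℕ b)))

  -- In the reversed list a₁ + 1 precedes a₁, so no chain from 1 gets past vertex a₁ + 1.
  F-broken : ∀ b {a₁ a₂} → (a₁ , a₂) ∈ ascents m → 1 ≤ a₁ → a₁ < a₂ → suc a₁ < label b → F b zero ≈ 0#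
  F-broken b {a₁} {a₂} s∈ 1≤a₁ a₁<a₂ 1+a₁<b = trans (F-entry b zero)
    (chainSum-broken (λ _ → 1#) unique-reverse-σ 1≤a₁ 1+a₁<b
      (reverse⁺ (blockReversal-⊆ (maximalSegments-reversal 1ℤ m) a₁ 2 s∈
        (ℕₚ.m≤n⇒m≤1+n (ℕₚ.<⇒≤ a₁<a₂)) ℕₚ.≤-refl
        (≡.subst (_≤ suc a₂) (ℕₚ.+-comm 2 a₁) (s≤s a₁<a₂)))))

  first-row-nothing : head (ascents m) ≡ nothing → ∀ {X Y} → X ≋ Y · F →
    entry X 1 1 ≈ firstRowSum Y 1 (suc r)
  first-row-nothing none {X} {Y} X≋YF = FirstRows.first-entry S r {X} {Y} {F} (suc r) X≋YF ℕₚ.≤-refl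
    (λ k _ → F-initial k (noSegments (ascents m) none))
    (λ k 1+r≤k → contradiction (Finₚ.toℕ<n k) (ℕₚ.≤⇒≯ 1+r≤k))
    where
    noSegments : ∀ {p} {Q : ℕ × ℕ → Set p} segs → head segs ≡ nothing → All Q segs
    noSegments [] _ = []

  first-row-just : ∀ {a₁ a₂} → head (ascents m) ≡ just (a₁ , a₂) → ∀ {X Y} → X ≋ Y · F →
    entry X 1 1 ≈ firstRowSum Y 1 (suc a₁)
  first-row-just {a₁} {a₂} first {X} {Y} X≋YF =
    FirstRows.first-entry S r {X} {Y} {F} (suc a₁) X≋YF (s≤s (ℕₚ.≤-trans (ℕₚ.<⇒≤ a₁<a₂) a₂≤r))
      (λ k k< → F-initial k (All.map (λ a₁≤α → ℕₚ.≤-trans k< (s≤s a₁≤α))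
        (firstLeast (ascents m) first (maximalSegments-sorted 1ℤ m))))
      (λ k 1+a₁≤k → F-broken k s∈ 1≤a₁ a₁<a₂ (s≤s 1+a₁≤k))
    where
    head-∈ : ∀ {s : ℕ × ℕ} segs → head segs ≡ just s → s ∈ segs
    head-∈ (_ ∷ _) ≡.refl = here ≡.refl
    s∈ = head-∈ (ascents m) first
    bounds = All.lookup (maximalSegments-between 1ℤ m) s∈
    1≤a₁ = proj₁ bounds
    a₁<a₂ = proj₁ (proj₂ bounds)
    a₂≤r = proj₂ (proj₂ bounds)
    firstLeast : ∀ segs → head segs ≡ just (a₁ , a₂) → AllPairs Before segs → All (λ s → a₁ ≤ proj₁ s) segs
    firstLeast (_ ∷ _) ≡.refl (before ∷ _) =
      -- The list is sorted from left to right, so its head has the least starting point, as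
      -- `F-initial` requires.
      ℕₚ.≤-refl ∷ All.map (λ a₂<α → ℕₚ.<⇒≤ (ℕₚ.<-trans a₁<a₂ a₂<α)) before

theorem7p1 : ∀ {c ℓ} (K : Field c ℓ) (r : ℕ) → 1 ≤ r →
    (m : Vector ℤ r) → IsMotzkin m →
    (R : ℕ → ℤ → Field.Carrier K) → IsQSystem K r R →
    AlgebraicallyIndependent K (initialData K r R) →
    let open Compactified K m R in
    Invertible I _·_ (I ⊖ T′) ×
    Invertible I _·_ (I ⊖ t • P) ×
    (∀ X Y → X IsInverseOf (I ⊖ T′) → Y IsInverseOf (I ⊖ t • P) →
    (X ≋ Y · F) ×
    (∀ a₁ a₂ → head (ascents m) ≡ just (a₁ , a₂) →
    (1 < a₁ → entry X 1 1 ≈ₛ firstRowSum Y 1 (suc a₁)) ×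
    (a₁ ≡ 1 → entry X 1 1 ≈ₛ (entry Y 1 1 +ₛ entry Y 1 2))) ×
    (head (ascents m) ≡ nothing → entry X 1 1 ≈ₛ firstRowSum Y 1 (suc r)))
theorem7p1 K r _ m motzkin R Q independent =
  (Z · F , factor {Z} Z-inverse) , (Z , Z-inverse) , λ X Y X-inverse Y-inverse →
    let X≋YF = inverse-unique {I ⊖ T′} {X} {Y · F} X-inverse (factor {Y} Y-inverse) in
    X≋YF
    , (λ a₁ a₂ first →
        (λ _ → first-row-just first {X} {Y} X≋YF)
      -- For a₁ = 1 the range is [1 ⋯ 2], and only the zero ending the list sum is to be removed.
      , λ { ≡.refl → S.trans (first-row-just first {X} {Y} X≋YF)
                       (S.+-congˡ {x = entry Y 1 1} (S.+-identityʳ (entry Y 1 2))) })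
    , λ none → first-row-nothing none {X} {Y} X≋YF
  where
  open Compactified K m R
  open FirstColumn K m R using (first-row-just; first-row-nothing)
  open TransferMatrix K m R (yOdd-≉0 K m R (IsMotzkin.min≥0 motzkin) (λ n → R-≉0 K R Q independent n))
    using (F⁻¹; F·F⁻¹; F⁻¹·F; T′-identity; coefficient)
  module S = CommutativeRing (SeriesProperties.seriesCommutativeRing (Field.commutativeRing K))
  open MatrixProperties (SeriesProperties.seriesCommutativeRing (Field.commutativeRing K)) (suc r)
  open Resolvents (SeriesProperties.seriesCommutativeRing (Field.commutativeRing K)) (suc r)
  open ConstantMatrices (Field.commutativeRing K) (suc r)

  factored : F · (I ⊖ T′) ≋ I ⊖ t • P
  factored = ≋-trans
    (factorisation {F} {F⁻¹} {T′} {D · U} t F·F⁻¹ T′-identity)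
    (⊖-cong (≋-refl {I}) (•-cong t (≋-sym (·-assoc F D U))))

  factor : ∀ {Y} → Y IsInverseOf (I ⊖ t • P) → (Y · F) IsInverseOf (I ⊖ T′)
  factor {Y} = inverse-factor {F} {F⁻¹} {I ⊖ T′} {I ⊖ t • P} {Y} F·F⁻¹ F⁻¹·F factored

  f-constant : ∀ i → IsConstantMatrix (f i)
  f-constant i = ⊕-constant {I} {E (suc i) i} I-constant (E-constant (suc i) i)

  d-constant : ∀ i → IsConstantMatrix (d i)
  d-constant i = ⊕-constant {I} {(const (yOdd i) S.+ S.- S.1#) • E i i} I-constant
    (•-constant {const (yOdd i) S.+ S.- S.1#} {E i i}
      (+-constant {const (yOdd i)} {S.- S.1#} (const-constant (yOdd i))
        (neg-constant {S.1#} (const-constant (Field.1# K))))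
      (E-constant i i))

  e-constant : ∀ i → IsConstantMatrix (e i)
  e-constant i = ⊕-constant {I} {const (coefficient i) • E i (suc i)} I-constant
    (•-constant {const (coefficient i)} {E i (suc i)} (const-constant (coefficient i)) (E-constant i (suc i)))

  -- The variable t enters only through the scalar in front of `P`, so the geometric series applies
  -- and supplies the invertibility claims.
  P-constant : IsConstantMatrix P
  P-constant = ·-constant {F · D} {U}
    (·-constant {F} {D} (∏-constant f-constant (σ m)) (∏-constant d-constant [ 1 ⋯ suc r ]))
    (∏-constant e-constant (τ m))

  Z : Matrix
  Z = geometric {P} P-constant

  Z-inverse : Z IsInverseOf (I ⊖ t • P)
  Z-inverse = geometric-inverse {P} P-constant
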